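{- Let $M\in\varinjlim\mathbf{Mod}^{\varphi_q,\Gamma_{LT},\acute{e}t,tor}_{/\mathcal{O}_{\mathcal{E}}}$. The morphism of complexes $\Phi^\bullet(M^\Delta)\to\Psi^\bullet(M^\Delta)$ given by $\mathrm{id}$ in degree $0$ and $-\psi_M$ in degree $1$ induces a morphism $\Phi\Gamma_{LT}^\bullet(M)\to\Psi\Gamma_{LT}^\bullet(M)$, and hence a well-defined homomorphism $$\mathcal{H}^i(\Phi\Gamma_{LT}^{\bullet}(M))\rightarrow\mathcal{H}^i(\Psi\Gamma_{LT}^{\bullet}(M))\qquad\text{for all } i\ge0.$$ Further, the homomorphism $\mathcal{H}^0(\Phi\Gamma_{LT}^{\bullet}(M))\to\mathcal{H}^0(\Psi\Gamma_{LT}^{\bullet}(M))$ is injective.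
   Context: Fields. $p$ is a prime, $L/\mathbb{Q}_p$ is finite of degree $d$, with ring of integers $\mathcal{O}_L$, uniformizer $\pi_L$ and residue field $k_L$ with $q=p^r$ elements. $\mathcal{G}$ is the Lubin--Tate formal $\mathcal{O}_L$-module over $\mathcal{O}_L$ attached to $\pi_L$, with power series $[a]_{\mathcal{G}}(X)$, and Tate module $\mathcal{TG}$. $L_\infty$ is obtained from $L$ by adjoining all $\pi_L$-power torsion points of $\mathcal{G}$; $\mathrm{Gal}(L_\infty/L)\cong\mathcal{O}_L^\times\cong\mu_{q-1}\oplus\mathbb{Z}/p^a\mathbb{Z}\oplus\mathbb{Z}_p^d$. $K\subset L_\infty$ is the fixed field of the subgroup $\mu_{q-1}\oplus\mathbb{Z}_p^d$; $k$ is its residue field, $\bar K$ an algebraic closure, $G_K=\mathrm{Gal}(\bar K/K)$, $K_\infty=L_\infty$, $H_K=\mathrm{Gal}(\bar K/K_\infty)$, $\Gamma_{LT}=\mathrm{Gal}(K_\infty/K)=\mu_{q-1}\oplus\mathbb{Z}_p^d$, $\Delta=\mu_{q-1}$, $\Gamma_{LT}^*=\Gamma_{LT}/\Delta$ with topological generators $\gamma_1,\dots,\gamma_d$. $\chi_{LT}:\Gamma_{LT}\to\mathcal{O}_L^\times$ is the character on $\mathcal{TG}$. Period rings. $\mathcal{R}=\varprojlim_{x\mapsto x^q}\mathcal{O}_{\bar K}/\pi_L\mathcal{O}_{\bar K}$, with fraction field $\mathrm{Fr}(\mathcal{R})$; $A_L=A\otimes_{W(k_L)}\mathcal{O}_L$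 for a $W(k_L)$-algebra $A$; $\varphi_q$ on $W(\mathrm{Fr}(\mathcal{R}))_L$ is ($q$-Frobenius)$\otimes\mathrm{id}$. For a fixed generator $v=(v_n)$ of $\mathcal{TG}$, $\{\iota(v)\}\in W(\mathcal{R})_L$ is the unique lift of $\iota(v)=(v_n\bmod\pi_L)_n\in\mathcal{R}$ with $\varphi_q(\{\iota(v)\})=[\pi_L]_{\mathcal{G}}(\{\iota(v)\})$. $\mathcal{O}_{\mathcal{E}}\subset W(\mathrm{Fr}(\mathcal{R}))_L$ is the $p$-adic completion of $W(k)_L[[X]][1/X]$, embedded by $X\mapsto\{\iota(v)\}$; $\varphi_q(X)=[\pi_L]_{\mathcal{G}}(X)$, $\gamma(X)=[\chi_{LT}(\gamma)]_{\mathcal{G}}(X)$. $\mathcal{O}_{\widehat{\mathcal{E}^{ur}}}\subset W(\mathrm{Fr}(\mathcal{R}))_L$ is the $p$-adic completion of the maximal integral unramified extension of $\mathcal{O}_{\mathcal{E}}$ in $W(\mathrm{Fr}(\mathcal{R}))_L$, with fraction field $\widehat{\mathcal{E}^{ur}}$. Modules. A $(\varphi_q,\Gamma_{LT})$-module over $\mathcal{O}_{\mathcal{E}}$ is an $\mathcal{O}_{\mathcal{E}}$-module $M$ with a $\varphi_q$-semilinear map $\varphi_M$ and a continuous semilinear $\Gamma_{LT}$-action commuting with $\varphi_M$; it is étale if it is finitely generated and $M\otimes_{\mathcal{O}_{\mathcal{E}},\varphi_q}\mathcal{O}_{\mathcal{E}}\to M$ is an isomorphism. $\varinjlim\mathbf{Mod}^{\varphi_q,\Gamma_{LT},\acute{e}t,tor}_{/\mathcal{O}_{\mathcal{E}}}$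 is the category of injective (filtered direct) limits of $\pi_L$-power torsion étale $(\varphi_q,\Gamma_{LT})$-modules over $\mathcal{O}_{\mathcal{E}}$. Each such $M$ is of the form $\mathbb{D}_{LT}(V)=(\mathcal{O}_{\widehat{\mathcal{E}^{ur}}}\otimes_{\mathcal{O}_L}V)^{H_K}$ for a discrete $\pi_L$-primary $\mathcal{O}_L$-linear representation $V$ of $G_K$. Operator $\psi$. $\widehat{\mathcal{E}^{ur}}$ has degree $q$ over $\varphi_q(\widehat{\mathcal{E}^{ur}})$; $\psi_q:\widehat{\mathcal{E}^{ur}}\to\widehat{\mathcal{E}^{ur}}$ is defined by $\varphi_q(\psi_q(x))=\pi_L^{ -1}\mathrm{trace}_{\widehat{\mathcal{E}^{ur}}/\varphi_q(\widehat{\mathcal{E}^{ur}})}(x)$. It preserves $\mathcal{O}_{\widehat{\mathcal{E}^{ur}}}$ and $\mathcal{O}_{\mathcal{E}}$, commutes with $G_K$, and $\psi_q\circ\varphi_q=\frac{q}{\pi_L}\mathrm{id}$. $\psi_M$ on $M=\mathbb{D}_{LT}(V)$ is induced by $\psi_q\otimes\mathrm{id}_V$; it commutes with $\Gamma_{LT}$ and $\psi_M\circ\varphi_M=\frac{q}{\pi_L}\mathrm{id}_M$. Complexes (first nonzero term in degree $0$; $\mathcal{H}^i$ denotes cohomology). $\Phi^\bullet(N): N\xrightarrow{\varphi_N-\mathrm{id}}N$; $\Psi^\bullet(N): N\xrightarrow{\psi_N-\frac{q}{\pi_L}\mathrm{id}}N$. For a $\Gamma_{LT}^*$-module $A$,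 $\Gamma_{LT}^\bullet(A)$ is the Koszul complex whose degree $r$ term is $\bigoplus_{S\subset\{1,\dots,d\},|S|=r}A$, with component from $S$ to $S\cup\{j\}$ ($j\notin S$) equal to $(-1)^{\#\{i\in S:\,i<j\}}(\gamma_j-\mathrm{id})$ and other components $0$. $\Phi\Gamma_{LT}^\bullet(M)$, $\Psi\Gamma_{LT}^\bullet(M)$ are the total complexes of the double complexes $\Gamma_{LT}^\bullet(\Phi^\bullet(M^\Delta))$, $\Gamma_{LT}^\bullet(\Psi^\bullet(M^\Delta))$. -}

module Defs where

open import Level using (0ℓ)
open import Algebra.Bundles using (AbelianGroup; CommutativeRing; Semiring)
open import Algebra.Module.Bundles using (LeftModule)
open import Algebra.Morphism.Structures using (IsGroupHomomorphism; IsRingHomomorphism)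
import Algebra.Construct.Terminal
import Algebra.Module.Construct.TensorUnit
import Algebra.Properties.AbelianGroup
import Algebra.Properties.CommutativeMonoid.Sum
import Algebra.Properties.CommutativeSemigroup
open import Data.Bool.Base using (true; false; if_then_else_)
open import Data.Fin.Subset using (Subset; inside; outside; ∣_∣) renaming (_-_ to _∖_)
open import Data.Fin.Subset.Properties using (p─⊥≡p)
import Data.Nat.Properties as ℕ
import Relation.Binary.Reasoning.Setoid
import Algebra.Definitions.RawSemiring
import Algebra.Properties.Semiring.Sum
open import Data.Fin.Base using (Fin; zero; suc; toℕ)
open import Data.Fin.Patterns using (0F; 1F; 2F)
import Data.Integer.Base as ℤ
import Data.Integer.Properties as ℤ
open import Data.List.Base as List using (List; []; _∷_; _++_; foldr; concatMap; upTo)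
import Data.List.Properties as List
open import Data.List.Relation.Unary.All using (All)
open import Data.Nat.Base as ℕ using (ℕ; zero; suc)
open import Data.Nat.Properties using (_≟_)
open import Data.Sum.Base using (_⊎_; inj₁)
open import Data.Product.Base using (Σ; Σ-syntax; ∃; ∃-syntax; _×_; _,_; proj₁; proj₂)
import Data.Vec.Functional as Vector
open import Data.Vec.Base as Vec using (Vec; []; _∷_; lookup)
import Data.Vec.Properties as Vec
open import Function.Base using (_∘_; id)
open import Function.Bundles using (Equivalence; Inverse; _⇔_)
open import Relation.Binary.PropositionalEquality as ≡ using (_≡_)
open import Relation.Nullary using (¬_; yes; no; contradiction)

CRing : Set₁
CRing = CommutativeRing 0ℓ 0ℓ

module Ops (A : CRing) where
  open CommutativeRing A public using (Carrier; _≈_; _+_; _*_; -_; _-_; 0#; 1#)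
  open CommutativeRing A using (semiring)
  open Algebra.Definitions.RawSemiring (Semiring.rawSemiring semiring) public using (_∣_; _^_)
  open Algebra.Properties.Semiring.Sum semiring public using (sum)

  fromℕ : ℕ → Carrier
  fromℕ zero    = 0#
  fromℕ (suc n) = 1# + fromℕ n

  Unit : Carrier → Set
  Unit x = x ∣ 1#

  _≡_mod_ : Carrier → Carrier → Carrier → Set
  x ≡ y mod z = z ∣ (x - y)

  partialSum : (ℕ → Carrier) → ℕ → Carrier
  partialSum f n = sum {n} (f ∘ toℕ)

  -- y = Σ f i for the linear topology given by the neighbourhoods U n of 0.
  Converges : (ℕ → Carrier → Set) → (ℕ → Carrier) → Carrier → Set
  Converges U f y = ∀ n → ∃[ N ] (∀ N′ → N ℕ.≤ N′ → U n (y - partialSum f N′))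

  -- The value at x of the monic polynomial X ^ n + Σ c i X ^ i, and of its derivative.
  monic monic′ : (n : ℕ) → (Fin n → Carrier) → Carrier → Carrier
  monic  n c x = x ^ n + sum (λ i → c i * x ^ toℕ i)
  monic′ n c x = fromℕ n * x ^ (n ℕ.∸ 1) + sum (λ i → c i * (fromℕ (toℕ i) * x ^ (toℕ i ℕ.∸ 1)))

record Hom (A B : CRing) : Set where
  private
    module A = CommutativeRing A
    module B = CommutativeRing B
  field
    ⟦_⟧                : A.Carrier → B.Carrier
    isRingHomomorphism : IsRingHomomorphism A.rawRing B.rawRing ⟦_⟧
  open IsRingHomomorphism isRingHomomorphism public

open Hom public using (⟦_⟧)

module _ {A B C : CRing} where
  infixr 9 _⊚_
  _⊚_ : Hom B C → Hom A B → Hom A C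
  g ⊚ f = record
    { ⟦_⟧ = ⟦ g ⟧ ∘ ⟦ f ⟧
    ; isRingHomomorphism = isRingHomomorphism (CommutativeRing.trans C) (Hom.isRingHomomorphism f) (Hom.isRingHomomorphism g) }
    where open import Algebra.Morphism.Construct.Composition using (isRingHomomorphism)

idHom : (A : CRing) → Hom A A
idHom A = record
  { ⟦_⟧ = id
  ; isRingHomomorphism = isRingHomomorphism (CommutativeRing.rawRing A) (CommutativeRing.refl A) }
  where open import Algebra.Morphism.Construct.Identity using (isRingHomomorphism)

infix 4 _≗_
_≗_ : {A B : CRing} → Hom A B → Hom A B → Set
_≗_ {A} {B} f g = ∀ x → CommutativeRing._≈_ B (⟦ f ⟧ x) (⟦ g ⟧ x)

-- Notions of commutative algebra.  Subrings, quotients and completions are given by a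
-- homomorphism with the defining property.

IsField : CRing → Set
IsField A = ¬ (1# ≈ 0#) × (∀ x → ¬ (x ≈ 0#) → Unit x)
  where open Ops A

module _ {A B : CRing} (f : Hom A B) where
  private
    module A = Ops A
    module B = Ops B

  Injective Surjective : Set
  Injective  = ∀ {x y} → ⟦ f ⟧ x B.≈ ⟦ f ⟧ y → x A.≈ y
  Surjective = ∀ y → ∃[ x ] ⟦ f ⟧ x B.≈ y

  Image : B.Carrier → Set
  Image y = ∃[ x ] ⟦ f ⟧ x B.≈ y

  record IsSubring {ℓ} (P : B.Carrier → Set ℓ) : Set ℓ where
    field
      injective : Injective
      image     : ∀ y → P y ⇔ Image y

  record IsFractionField : Set where
    field
      isField   : IsField B
      injective : Injective
      fraction  : ∀ y → ∃[ a ] ∃[ s ] (¬ (s A.≈ A.0#) × y B.* ⟦ f ⟧ s B.≈ ⟦ f ⟧ a)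

  record IsQuotientBy (a : A.Carrier) : Set where
    field
      surjective : Surjective
      kernel     : ∀ x → ⟦ f ⟧ x B.≈ B.0# ⇔ a A.∣ x

  -- A is a local ring and B its residue field.
  record IsResidueField : Set where
    field
      isField    : IsField B
      surjective : Surjective
      kernel     : ∀ x → ⟦ f ⟧ x B.≈ B.0# ⇔ (¬ A.Unit x)

  -- B = lim A / a ^ n.
  record IsAdicCompletion (a : A.Carrier) : Set where
    private
      a^_ : ℕ → B.Carrier
      a^ n = ⟦ f ⟧ a B.^ n
    field
      mod-injective  : ∀ n x → (a^ n) B.∣ ⟦ f ⟧ x → (a A.^ n) A.∣ x
      mod-surjective : ∀ n y → ∃[ x ] ⟦ f ⟧ x B.≡ y mod (a^ n)
      separated      : ∀ y → (∀ n → (a^ n) B.∣ y) → y B.≈ B.0#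
      complete       : ∀ (s : ℕ → B.Carrier) → (∀ n → s (suc n) B.≡ s n mod (a^ n)) →
                       ∃[ y ] (∀ n → y B.≡ s n mod (a^ n))

  record IsBasis (n : ℕ) (b : Fin n → B.Carrier) : Set where
    field
      coord  : B.Carrier → Fin n → A.Carrier
      expand : ∀ y → y B.≈ B.sum (λ i → ⟦ f ⟧ (coord y i) B.* b i)
      unique : ∀ y (c : Fin n → A.Carrier) → y B.≈ B.sum (λ i → ⟦ f ⟧ (c i) B.* b i) → ∀ i → c i A.≈ coord y i

    trace : B.Carrier → A.Carrier
    trace y = A.sum (λ i → coord (y B.* b i) i)

  Integral : B.Carrier → Set
  Integral y = ∃[ n ] Σ[ c ∈ (Fin n → A.Carrier) ] B.monic n (⟦ f ⟧ ∘ c) y B.≈ B.0#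

  record IsAlgebraicClosure : Set where
    field
      isField   : IsField B
      algebraic : ∀ y → Integral y
      closed    : ∀ n (c : Fin (suc n) → B.Carrier) → ∃[ y ] B.monic (suc n) c y B.≈ B.0#

record IsIntegralClosure {A B C : CRing} (f : Hom A C) (e : Hom B C) : Set where
  field
    injective : Injective e
    image     : ∀ y → Integral f y ⇔ Image e y

-- The tensor product of commutative A-algebras is their coproduct.
record TensorAlgebra {A B C : CRing} (f : Hom A B) (g : Hom A C) : Set₁ where
  field
    ring      : CRing
    left      : Hom B ring
    right     : Hom C ring
    commutes  : left ⊚ f ≗ right ⊚ g
    universal : ∀ (D : CRing) (u : Hom B D) (v : Hom C D) → u ⊚ f ≗ v ⊚ g →
                Σ[ h ∈ Hom ring D ] (h ⊚ left ≗ u × h ⊚ right ≗ v)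
    unique    : ∀ (D : CRing) (h h′ : Hom ring D) →
                h ⊚ left ≗ h′ ⊚ left → h ⊚ right ≗ h′ ⊚ right → h ≗ h′

-- Formal power series in n variables, indexed by exponent vectors.
module PowerSeries (A : CRing) where
  open Ops A

  Series : ℕ → Set
  Series n = Vec ℕ n → Carrier

  infix 4 _≈ₛ_
  _≈ₛ_ : ∀ {n} → Series n → Series n → Set
  f ≈ₛ g = ∀ α → f α ≈ g α

  monomial : ∀ {n} → Vec ℕ n → Series n
  monomial β α with Vec.≡-dec _≟_ α β
  ... | yes _ = 1#
  ... | no  _ = 0#

  𝟘 : ∀ {n} → Series n
  𝟘 _ = 0#

  X : ∀ {n} → Fin n → Series n
  X {n} i = monomial (Vec.replicate n 0 Vec.[ i ]≔ 1)

  sumList : List Carrier → Carrier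
  sumList = foldr _+_ 0#

  splittings : ∀ {n} → Vec ℕ n → List (Vec ℕ n × Vec ℕ n)
  splittings []      = ([] , []) ∷ []
  splittings (k ∷ α) = concatMap (λ i → List.map (λ (β , γ) → i ∷ β , (k ℕ.∸ i) ∷ γ) (splittings α)) (upTo (suc k))

  _·_ : ∀ {n} → Series n → Series n → Series n
  (f · g) α = sumList (List.map (λ (β , γ) → f β * g γ) (splittings α))

  monomialIn : ∀ {m n} → Vec (Series n) m → Vec ℕ m → Series n
  monomialIn {n = n} []       []            = monomial (Vec.replicate n 0)
  monomialIn         (g ∷ gs) (zero  ∷ β) = monomialIn gs β
  monomialIn         (g ∷ gs) (suc k ∷ β) = g · monomialIn (g ∷ gs) (k ∷ β)

  box : ∀ m → ℕ → List (Vec ℕ m)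
  box zero    N = [] ∷ []
  box (suc m) N = concatMap (λ i → List.map (i ∷_) (box m N)) (upTo (suc N))

  -- f(g₁, …, gₘ) for gᵢ without constant term: then g ^ β contributes to the coefficient
  -- of X ^ α only if all entries of β are at most the total degree of α.
  _⟪_⟫ : ∀ {m n} → Series m → Vec (Series n) m → Series n
  _⟪_⟫ {m} f gs α = sumList (List.map (λ β → f β * monomialIn gs β α) (box m (Vec.sum α)))

  constantTerm : ∀ {n} → Series n → Carrier
  constantTerm {n} f = f (Vec.replicate n 0)

ghost : (p : ℕ) (A : CRing) → ℕ → (ℕ → CommutativeRing.Carrier A) → CommutativeRing.Carrier A
ghost p A n x = sum {suc n} (λ i → fromℕ (p ℕ.^ toℕ i) * x (toℕ i) ^ (p ℕ.^ (n ℕ.∸ toℕ i)))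
  where open Ops A

-- The functorial ring structure on sequences for which all ghost components are ring homomorphisms.
record WittVectors (p : ℕ) : Set₁ where
  field
    W                : CRing → CRing
    coord            : ∀ A → CommutativeRing.Carrier (W A) → ℕ → CommutativeRing.Carrier A
    coord-cong       : ∀ A {x y} → CommutativeRing._≈_ (W A) x y →
                       ∀ n → CommutativeRing._≈_ A (coord A x n) (coord A y n)
    coord-injective  : ∀ A {x y} → (∀ n → CommutativeRing._≈_ A (coord A x n) (coord A y n)) →
                       CommutativeRing._≈_ (W A) x y
    coord-surjective : ∀ A (s : ℕ → CommutativeRing.Carrier A) →
                       ∃[ x ] (∀ n → CommutativeRing._≈_ A (coord A x n) (s n))
    W₁               : ∀ {A B} → Hom A B → Hom (W A) (W B)
    W₁-coord         : ∀ {A B} (f : Hom A B) x n →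
                       CommutativeRing._≈_ B (coord B (⟦ W₁ f ⟧ x) n) (⟦ f ⟧ (coord A x n))
    ghost-homomorphic : ∀ A n → IsRingHomomorphism (CommutativeRing.rawRing (W A)) (CommutativeRing.rawRing A)
                                                   (ghost p A n ∘ coord A)

record LocalField (p : ℕ) : Set₁ where
  field
    Zp Qp L OL kL : CRing

    ℤ→Zp         : Hom ℤ.+-*-commutativeRing Zp
    Zp-completion : IsAdicCompletion ℤ→Zp (ℤ.+ p)
    Zp→Qp        : Hom Zp Qp
    Qp-fractions  : IsFractionField Zp→Qp

    L-field       : IsField L
    Qp→L         : Hom Qp L
    d             : ℕ
    L-basis       : Fin d → CommutativeRing.Carrier L
    L-finite      : IsBasis Qp→L d L-basis

    OL→L         : Hom OL L
    OL-integers   : IsIntegralClosure (Qp→L ⊚ Zp→Qp) OL→L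

    π             : CommutativeRing.Carrier OL
    uniformizer   : ∀ x → (¬ Ops.Unit OL x) ⇔ Ops._∣_ OL π x

    OL→kL        : Hom OL kL
    kL-residue    : IsResidueField OL→kL
    r             : ℕ
    kL-cardinality : Inverse (≡.setoid (Fin (p ℕ.^ r))) (CommutativeRing.setoid kL)

  q : ℕ
  q = p ℕ.^ r


-- The Lubin–Tate formal module attached to π.
record LubinTate {p : ℕ} (F : LocalField p) : Set where
  open LocalField F
  open PowerSeries OL
  private
    module OL = Ops OL
  field
    G           : Series 2
    G-constant  : constantTerm G OL.≈ OL.0#
    G-identityˡ : G ⟪ 𝟘 ∷ X 0F ∷ [] ⟫ ≈ₛ X {1} 0F
    G-identityʳ : G ⟪ X 0F ∷ 𝟘 ∷ [] ⟫ ≈ₛ X {1} 0F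
    G-comm      : G ⟪ X 1F ∷ X 0F ∷ [] ⟫ ≈ₛ G
    G-assoc     : G ⟪ G ⟪ X 0F ∷ X 1F ∷ [] ⟫ ∷ X 2F ∷ [] ⟫ ≈ₛ G ⟪ X {3} 0F ∷ G ⟪ X 1F ∷ X 2F ∷ [] ⟫ ∷ [] ⟫

    [_]G        : OL.Carrier → Series 1
    []-cong     : ∀ {a b} → a OL.≈ b → [ a ]G ≈ₛ [ b ]G
    []-constant : ∀ a → constantTerm [ a ]G OL.≈ OL.0#
    []-linear   : ∀ a → [ a ]G (1 ∷ []) OL.≈ a
    []-endo     : ∀ a → [ a ]G ⟪ G ∷ [] ⟫ ≈ₛ G ⟪ [ a ]G ⟪ X 0F ∷ [] ⟫ ∷ [ a ]G ⟪ X 1F ∷ [] ⟫ ∷ [] ⟫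
    []-one      : [ OL.1# ]G ≈ₛ X 0F
    []-add      : ∀ a b → [ a OL.+ b ]G ≈ₛ G ⟪ [ a ]G ∷ [ b ]G ∷ [] ⟫
    []-mul      : ∀ a b → [ a OL.* b ]G ≈ₛ [ a ]G ⟪ [ b ]G ∷ [] ⟫
    []-π        : ∀ α → [ π ]G α OL.≡ monomial (q ∷ []) α mod π

-- Automorphisms fixing the elements of P.
record Aut (Ω : CRing) (P : CommutativeRing.Carrier Ω → Set) : Set where
  open CommutativeRing Ω
  field
    to from : Hom Ω Ω
    to-from : to ⊚ from ≗ idHom Ω
    from-to : from ⊚ to ≗ idHom Ω
    fixes   : ∀ x → P x → ⟦ to ⟧ x ≈ x

open Aut public using (to; from)

module _ {Ω : CRing} where
  open CommutativeRing Ω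

  weaken : {P Q : Carrier → Set} → (∀ x → P x → Q x) → Aut Ω Q → Aut Ω P
  weaken P⊆Q σ = record { to = σ.to ; from = σ.from ; to-from = σ.to-from ; from-to = σ.from-to
                        ; fixes = λ x Px → σ.fixes x (P⊆Q x Px) }
    where module σ = Aut σ

  module _ {P : Carrier → Set} where
    idAut : Aut Ω P
    idAut = record { to = idHom Ω ; from = idHom Ω ; to-from = λ _ → refl ; from-to = λ _ → refl
                   ; fixes = λ _ _ → refl }

    infixr 9 _∘ₐ_
    _∘ₐ_ : Aut Ω P → Aut Ω P → Aut Ω P
    σ ∘ₐ τ = record
      { to = σ.to ⊚ τ.to ; from = τ.from ⊚ σ.from
      ; to-from = λ x → trans (Hom.⟦⟧-cong σ.to (τ.to-from (⟦ σ.from ⟧ x))) (σ.to-from x)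
      ; from-to = λ x → trans (Hom.⟦⟧-cong τ.from (σ.from-to (⟦ τ.to ⟧ x))) (τ.from-to x)
      ; fixes = λ x Px → trans (Hom.⟦⟧-cong σ.to (τ.fixes x Px)) (σ.fixes x Px) }
      where module σ = Aut σ
            module τ = Aut τ

    _⁻¹ₐ : Aut Ω P → Aut Ω P
    σ ⁻¹ₐ = record { to = σ.from ; from = σ.to ; to-from = σ.from-to ; from-to = σ.to-from
                  ; fixes = λ x Px → trans (Hom.⟦⟧-cong σ.from (sym (σ.fixes x Px))) (σ.from-to x) }
      where module σ = Aut σ

    _^ℕ_ : Aut Ω P → ℕ → Aut Ω P
    σ ^ℕ zero  = idAut
    σ ^ℕ suc n = σ ∘ₐ (σ ^ℕ n)

    _^ℤ_ : Aut Ω P → ℤ.ℤ → Aut Ω P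
    σ ^ℤ (ℤ.+ n)      = σ ^ℕ n
    σ ^ℤ (ℤ.-[1+ n ]) = (σ ⁻¹ₐ) ^ℕ suc n

    prodAut : ∀ {n} → (Fin n → Aut Ω P) → Aut Ω P
    prodAut = Vector.foldr _∘ₐ_ idAut

    AgreeOn : (Carrier → Set) → Aut Ω P → Aut Ω P → Set
    AgreeOn Q σ τ = ∀ x → Q x → ⟦ to σ ⟧ x ≈ ⟦ to τ ⟧ x

    AgreeOnList : List Carrier → Aut Ω P → Aut Ω P → Set
    AgreeOnList xs σ τ = All (λ x → ⟦ to σ ⟧ x ≈ ⟦ to τ ⟧ x) xs

-- The subfield generated by P.
data Generated (Ω : CRing) (P : CommutativeRing.Carrier Ω → Set) : CommutativeRing.Carrier Ω → Set where
  gen      : ∀ {x} → P x → Generated Ω P x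
  gen-resp : ∀ {x y} → CommutativeRing._≈_ Ω x y → Generated Ω P x → Generated Ω P y
  gen-one  : Generated Ω P (CommutativeRing.1# Ω)
  gen-add  : ∀ {x y} → Generated Ω P x → Generated Ω P y → Generated Ω P (CommutativeRing._+_ Ω x y)
  gen-neg  : ∀ {x} → Generated Ω P x → Generated Ω P (CommutativeRing.-_ Ω x)
  gen-mul  : ∀ {x y} → Generated Ω P x → Generated Ω P y → Generated Ω P (CommutativeRing._*_ Ω x y)
  gen-inv  : ∀ {x y} → CommutativeRing._≈_ Ω (CommutativeRing._*_ Ω x y) (CommutativeRing.1# Ω) →
         Generated Ω P x → Generated Ω P y

-- An internal decomposition of the unit group of OL as μ_{q-1} ⊕ ℤ/p^a ⊕ Zp^d,
-- with ξ a generator of the second summand and e the inclusion of the third one.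
record UnitDecomposition {p : ℕ} (F : LocalField p) : Set where
  open LocalField F
  private
    module OL = Ops OL
    module Zp = Ops Zp

  μ : OL.Carrier → Set
  μ ζ = ζ OL.^ (q ℕ.∸ 1) OL.≈ OL.1#

  field
    a            : ℕ
    ξ            : OL.Carrier
    ξ-order      : ξ OL.^ (p ℕ.^ a) OL.≈ OL.1#
    e            : (Fin d → Zp.Carrier) → OL.Carrier
    e-cong       : ∀ {z w} → (∀ i → z i Zp.≈ w i) → e z OL.≈ e w
    e-one        : e (λ _ → Zp.0#) OL.≈ OL.1#
    e-mul        : ∀ z w → e (λ i → z i Zp.+ w i) OL.≈ e z OL.* e w
    e-continuous : ∀ n → ∃[ m ] (∀ z → (∀ i → (Zp.fromℕ p Zp.^ m) Zp.∣ z i) → e z OL.≡ OL.1# mod (π OL.^ n))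
    exists       : ∀ u → OL.Unit u → ∃[ ζ ] Σ[ t ∈ Fin (p ℕ.^ a) ] ∃[ z ]
                   (μ ζ × u OL.≈ ζ OL.* ξ OL.^ toℕ t OL.* e z)
    unique       : ∀ ζ (t : Fin (p ℕ.^ a)) z → μ ζ → ζ OL.* ξ OL.^ toℕ t OL.* e z OL.≈ OL.1# →
                   ζ OL.≈ OL.1# × toℕ t ≡ 0 × (∀ i → z i Zp.≈ Zp.0#)

  -- The subgroup μ_{q-1} ⊕ Zp^d.
  μ⊕ℤp^d : OL.Carrier → Set
  μ⊕ℤp^d u = ∃[ ζ ] ∃[ z ] (μ ζ × u OL.≈ ζ OL.* e z)

-- Ω is an algebraic closure of L (hence of K ⊂ Ω), and OΩ its ring of integers.
record AlgebraicClosure {p : ℕ} {F : LocalField p} (LT : LubinTate F) : Set₁ where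
  open LocalField F
  open LubinTate LT
  field
    Ω OΩ            : CRing
    L→Ω             : Hom L Ω
    Ω-closure       : IsAlgebraicClosure L→Ω
    OΩ→Ω            : Hom OΩ Ω
    OΩ-integers     : IsIntegralClosure (L→Ω ⊚ OL→L) OΩ→Ω
    OL→OΩ           : Hom OL OΩ
    OL→OΩ-inclusion : OΩ→Ω ⊚ OL→OΩ ≗ L→Ω ⊚ OL→L

  private
    module OL = Ops OL
    module Ω  = Ops Ω
    module OΩ = Ops OΩ

  fromL : Ω.Carrier → Set
  fromL = Image L→Ω

  πΩ : OΩ.Carrier
  πΩ = ⟦ OL→OΩ ⟧ π

  𝔪 : OΩ.Carrier → Set
  𝔪 x = ¬ OΩ.Unit x

  -- f(x) = y, where the series is summed π-adically.
  Value : PowerSeries.Series OL 1 → OΩ.Carrier → OΩ.Carrier → Set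
  Value f x y = OΩ.Converges (λ n z → (πΩ OΩ.^ n) OΩ.∣ z) (λ i → ⟦ OL→OΩ ⟧ (f (i ∷ [])) OΩ.* x OΩ.^ i) y

  Torsion : OΩ.Carrier → Set
  Torsion x = 𝔪 x × (∃[ n ] Value [ π OL.^ n ]G x OΩ.0#)

  TateModule : (ℕ → OΩ.Carrier) → Set
  TateModule w = (∀ n → 𝔪 (w n)) × w 0 OΩ.≈ OΩ.0# × (∀ n → Value [ π ]G (w (suc n)) (w n))

  L∞ : Ω.Carrier → Set
  L∞ = Generated Ω (λ x → fromL x ⊎ (∃[ y ] (Torsion y × ⟦ OΩ→Ω ⟧ y Ω.≈ x)))

  GL : Set
  GL = Aut Ω fromL

record LubinTateCharacter {p : ℕ} {F : LocalField p} {LT : LubinTate F} (C : AlgebraicClosure LT) : Set where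
  open LocalField F
  open LubinTate LT
  open AlgebraicClosure C
  private
    module OL = Ops OL
    module Ω  = Ops Ω
    module OΩ = Ops OΩ
  field
    actO           : GL → Hom OΩ OΩ
    actO-inclusion : ∀ σ → OΩ→Ω ⊚ actO σ ≗ to σ ⊚ OΩ→Ω

    v              : ℕ → OΩ.Carrier
    v-Tate         : TateModule v
    v-generator    : ∀ w → TateModule w → ∃[ a ] (∀ n → Value [ a ]G (v n) (w n))

    -- The isomorphism Gal(L∞/L) → OL^×; Gal(L∞/L) is the quotient of GL by agreement on L∞.
    χ              : GL → OL.Carrier
    χ-Tate         : ∀ σ n → Value [ χ σ ]G (v n) (⟦ actO σ ⟧ (v n))
    χ-unit         : ∀ σ → OL.Unit (χ σ)
    χ-mul          : ∀ σ τ → χ (σ ∘ₐ τ) OL.≈ χ σ OL.* χ τ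
    χ-injective    : ∀ σ τ → χ σ OL.≈ χ τ ⇔ AgreeOn L∞ σ τ
    χ-surjective   : ∀ u → OL.Unit u → ∃[ σ ] χ σ OL.≈ u

    units          : UnitDecomposition F

  open UnitDecomposition units

  K : Ω.Carrier → Set
  K x = L∞ x × (∀ σ → μ⊕ℤp^d (χ σ) → ⟦ to σ ⟧ x Ω.≈ x)

  GK : Set
  GK = Aut Ω K

  asGL : GK → GL
  asGL = weaken (λ x x∈L → gen (inj₁ x∈L) , λ σ _ → Aut.fixes σ x x∈L)

  HK : GK → Set
  HK σ = AgreeOn L∞ σ idAut

  -- Γ_LT = Gal(K∞/K) is the quotient of GK by agreement on K∞ = L∞; its elements, in particular
  -- those of its subgroup Δ, are given by representatives in GK.
  Δ : GK → Set
  Δ σ = μ (χ (asGL σ))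

record BaseField {p : ℕ} {F : LocalField p} {LT : LubinTate F} {C : AlgebraicClosure LT}
                 (X : LubinTateCharacter C) : Set₁ where
  open LocalField F
  open AlgebraicClosure C
  open LubinTateCharacter X
  field
    -- The γ j topologically generate Γ_LT / Δ.
    γ               : Fin d → GK
    γ-generate      : ∀ σ xs → All L∞ xs → Σ[ m ∈ (Fin d → ℤ.ℤ) ] ∃[ δ ]
                      (Δ δ × AgreeOnList xs σ (prodAut (λ j → γ j ^ℤ m j) ∘ₐ δ))

    OK k            : CRing
    OK→OΩ           : Hom OK OΩ
    OK-integers     : IsSubring OK→OΩ (λ y → K (⟦ OΩ→Ω ⟧ y))
    OL→OK           : Hom OL OK
    OL→OK-inclusion : OK→OΩ ⊚ OL→OK ≗ OL→OΩ
    OK→k            : Hom OK k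
    k-residue       : IsResidueField OK→k
    kL→k            : Hom kL k
    kL→k-reduction  : kL→k ⊚ OL→kL ≗ OK→k ⊚ OL→OK

-- R = lim OΩ/π along x ↦ x ^ q and its fraction field.
record Perfection {p : ℕ} {F : LocalField p} {LT : LubinTate F} {C : AlgebraicClosure LT}
                  {X : LubinTateCharacter C} (B : BaseField X) : Set₁ where
  open LocalField F
  open AlgebraicClosure C
  open LubinTateCharacter X
  open BaseField B
  field
    OΩ/π R Fr       : CRing
  private
    module OΩ   = Ops OΩ
    module OΩ/π = Ops OΩ/π
    module R    = Ops R
    module Fr   = Ops Fr
  field
    OΩ→OΩ/π         : Hom OΩ OΩ/π
    OΩ/π-quotient   : IsQuotientBy OΩ→OΩ/π πΩ
    pr              : ℕ → Hom R OΩ/π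
    pr-compatible   : ∀ n x → ⟦ pr (suc n) ⟧ x OΩ/π.^ q OΩ/π.≈ ⟦ pr n ⟧ x
    pr-injective    : ∀ x y → (∀ n → ⟦ pr n ⟧ x OΩ/π.≈ ⟦ pr n ⟧ y) → x R.≈ y
    pr-surjective   : ∀ (s : ℕ → OΩ/π.Carrier) → (∀ n → s (suc n) OΩ/π.^ q OΩ/π.≈ s n) →
                      ∃[ x ] (∀ n → ⟦ pr n ⟧ x OΩ/π.≈ s n)
    R→Fr            : Hom R Fr
    Fr-fractions    : IsFractionField R→Fr
    -- The k-algebra structure of R: over the residue field of OΩ it becomes the inclusion of k.
    k→R             : Hom k R
    k→R-residue     : ∀ a y → ⟦ OΩ→OΩ/π ⟧ y OΩ/π.≈ ⟦ pr 0 ⟧ (⟦ k→R ⟧ (⟦ OK→k ⟧ a)) →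
                      𝔪 (y OΩ.- ⟦ OK→OΩ ⟧ a)

    Frobenius       : Hom Fr Fr
    Frobenius-power : ∀ x → ⟦ Frobenius ⟧ x Fr.≈ x Fr.^ q
    gOΩ/π           : GK → Hom OΩ/π OΩ/π
    gOΩ/π-reduction : ∀ σ → gOΩ/π σ ⊚ OΩ→OΩ/π ≗ OΩ→OΩ/π ⊚ actO (asGL σ)
    gR              : GK → Hom R R
    gR-pr           : ∀ σ n → pr n ⊚ gR σ ≗ gOΩ/π σ ⊚ pr n
    gFr             : GK → Hom Fr Fr
    gFr-extends     : ∀ σ → gFr σ ⊚ R→Fr ≗ R→Fr ⊚ gR σ

    ιv              : R.Carrier
    ιv-pr           : ∀ n → ⟦ pr n ⟧ ιv OΩ/π.≈ ⟦ OΩ→OΩ/π ⟧ (v n)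

record WittRings {p : ℕ} {F : LocalField p} {LT : LubinTate F} {C : AlgebraicClosure LT}
                 {X : LubinTateCharacter C} {B : BaseField X} (P : Perfection B) : Set₁ where
  open LocalField F
  open LubinTateCharacter X using (GK)
  open BaseField B
  open Perfection P
  field
    witt            : WittVectors p
  open WittVectors witt
  private
    module kL = Ops kL
    module R  = Ops R
  field
    WkL→OL          : Hom (W kL) OL
    WkL→OL-residue  : ∀ x → ⟦ OL→kL ⟧ (⟦ WkL→OL ⟧ x) kL.≈ coord kL x 0
    Wk-L            : TensorAlgebra (W₁ kL→k) WkL→OL
    WR-L            : TensorAlgebra (W₁ (k→R ⊚ kL→k)) WkL→OL
    WF-L            : TensorAlgebra (W₁ (R→Fr ⊚ k→R ⊚ kL→k)) WkL→OL
  -- W(k)_L, W(R)_L and W(Fr(R))_L.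
  module Wk = TensorAlgebra Wk-L
  module WR = TensorAlgebra WR-L
  module WF = TensorAlgebra WF-L
  field
    Wk→WR           : Hom Wk.ring WR.ring
    Wk→WR-left      : Wk→WR ⊚ Wk.left ≗ WR.left ⊚ W₁ k→R
    Wk→WR-right     : Wk→WR ⊚ Wk.right ≗ WR.right
    WR→WF           : Hom WR.ring WF.ring
    WR→WF-left      : WR→WF ⊚ WR.left ≗ WF.left ⊚ W₁ R→Fr
    WR→WF-right     : WR→WF ⊚ WR.right ≗ WF.right

    φW              : Hom WF.ring WF.ring
    φW-left         : φW ⊚ WF.left ≗ WF.left ⊚ W₁ Frobenius
    φW-right        : φW ⊚ WF.right ≗ WF.right
    gW              : GK → Hom WF.ring WF.ring
    gW-left         : ∀ σ → gW σ ⊚ WF.left ≗ WF.left ⊚ W₁ (gFr σ)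
    gW-right        : ∀ σ → gW σ ⊚ WF.right ≗ WF.right

    -- The Teichmüller lift of ι(v).
    [ιv]            : CommutativeRing.Carrier (W R)
    [ιv]-zero       : coord R [ιv] 0 R.≈ ιv
    [ιv]-suc        : ∀ n → coord R [ιv] (suc n) R.≈ R.0#

  private
    module wr = Ops WR.ring

  -- The weak topology of W(R)_L: its neighbourhoods of 0 are generated by π ^ n and [ι(v)] ^ n.
  Weak : ℕ → wr.Carrier → Set
  Weak n z = ∃[ s ] ∃[ t ] z wr.≈ ⟦ WR.right ⟧ π wr.^ n wr.* s wr.+ ⟦ WR.left ⟧ [ιv] wr.^ n wr.* t

-- The element u = {ι(v)}.
record LubinTateElement {p : ℕ} {F : LocalField p} {LT : LubinTate F} {C : AlgebraicClosure LT}
                        {X : LubinTateCharacter C} {B : BaseField X} {P : Perfection B}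
                        (𝕎 : WittRings P) : Set where
  open LocalField F
  open LubinTate LT
  open WittRings 𝕎
  private
    module wr = Ops WR.ring
    module wf = Ops WF.ring
  field
    u               : wr.Carrier
    u-lift          : u wr.≡ ⟦ WR.left ⟧ [ιv] mod ⟦ WR.right ⟧ π
    φu              : wr.Carrier
    φu-frobenius    : ⟦ WR→WF ⟧ φu wf.≈ ⟦ φW ⟧ (⟦ WR→WF ⟧ u)
    φu-series       : wr.Converges Weak (λ i → ⟦ WR.right ⟧ ([ π ]G (i ∷ [])) wr.* u wr.^ i) φu

  uF : wf.Carrier
  uF = ⟦ WR→WF ⟧ u

  -- y = f(u) for some f in W(k)_L[[X]].
  PowerSeriesIn-u : wr.Carrier → Set
  PowerSeriesIn-u y = Σ[ f ∈ (ℕ → Ops.Carrier Wk.ring) ]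
                      wr.Converges Weak (λ i → ⟦ Wk→WR ⟧ (f i) wr.* u wr.^ i) y

  LaurentSeriesIn-u : wf.Carrier → Set
  LaurentSeriesIn-u x = ∃[ n ] ∃[ y ] (PowerSeriesIn-u y × x wf.* uF wf.^ n wf.≈ ⟦ WR→WF ⟧ y)

-- x lies in a finite unramified extension S ⊂ B of the discrete valuation ring A with
-- uniformizer a: the element a is still a uniformizer of S, and every element of S reduces to
-- a simple root of a monic polynomial over the residue field of A.
record InFiniteUnramified {A B : CRing} (f : Hom A B) (a : CommutativeRing.Carrier A)
                          (x : CommutativeRing.Carrier B) : Set₁ where
  field
    S          : CRing
    A→S       : Hom A S
    S→B       : Hom S B
    inclusion  : S→B ⊚ A→S ≗ f
    injective  : Injective S→B
    contains   : Image S→B x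
  private
    module A = Ops A
    module S = Ops S
  field
    size        : ℕ
    generators  : Fin size → S.Carrier
    finite      : ∀ y → Σ[ c ∈ (Fin size → A.Carrier) ] y S.≈ S.sum (λ i → ⟦ A→S ⟧ (c i) S.* generators i)
    uniformizer : ∀ y → (¬ S.Unit y) ⇔ ⟦ A→S ⟧ a S.∣ y
    separable   : ∀ y → ∃[ n ] Σ[ c ∈ (Fin n → A.Carrier) ]
                  (⟦ A→S ⟧ a S.∣ S.monic n (⟦ A→S ⟧ ∘ c) y × S.Unit (S.monic′ n (⟦ A→S ⟧ ∘ c) y))

record CoefficientRings {p : ℕ} {F : LocalField p} {LT : LubinTate F} {C : AlgebraicClosure LT}
                        {X : LubinTateCharacter C} {B : BaseField X} {P : Perfection B}
                        {𝕎 : WittRings P} (U : LubinTateElement 𝕎) : Set₁ where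
  open LocalField F
  open LubinTateCharacter X using (GK)
  open WittRings 𝕎
  open LubinTateElement U
  field
    -- W(k)_L[[X]][1/X], its p-adic completion OE, the maximal integral unramified extension
    -- Eur of OE in W(Fr(R))_L, and the p-adic completion Ô of Eur.
    Laurent OE Eur Ô : CRing
    Laurent→WF      : Hom Laurent WF.ring
    Laurent-image   : IsSubring Laurent→WF LaurentSeriesIn-u
    Laurent→OE      : Hom Laurent OE
    OE-completion   : IsAdicCompletion Laurent→OE (Ops.fromℕ Laurent p)
    OE→WF           : Hom OE WF.ring
    OE-injective    : Injective OE→WF
    OE-inclusion    : OE→WF ⊚ Laurent→OE ≗ Laurent→WF
    OL→OE           : Hom OL OE
    OL→OE-inclusion : OE→WF ⊚ OL→OE ≗ WF.right
    Eur→WF          : Hom Eur WF.ring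
    Eur-image       : IsSubring Eur→WF (InFiniteUnramified OE→WF (⟦ OL→OE ⟧ π))
    Eur→Ô           : Hom Eur Ô
    Ô-completion    : IsAdicCompletion Eur→Ô (Ops.fromℕ Eur p)
    Ô→WF            : Hom Ô WF.ring
    Ô-injective     : Injective Ô→WF
    Ô-inclusion     : Ô→WF ⊚ Eur→Ô ≗ Eur→WF
    OE→Ô            : Hom OE Ô
    OE→Ô-inclusion  : Ô→WF ⊚ OE→Ô ≗ OE→WF

    -- φ_q and GK preserve OE and Ô.
    φE              : Hom OE OE
    φE-restricts    : OE→WF ⊚ φE ≗ φW ⊚ OE→WF
    φO              : Hom Ô Ô
    φO-restricts    : Ô→WF ⊚ φO ≗ φW ⊚ Ô→WF
    gE              : GK → Hom OE OE
    gE-restricts    : ∀ σ → OE→WF ⊚ gE σ ≗ gW σ ⊚ OE→WF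
    gO              : GK → Hom Ô Ô
    gO-restricts    : ∀ σ → Ô→WF ⊚ gO σ ≗ gW σ ⊚ Ô→WF

  OL→Ô : Hom OL Ô
  OL→Ô = OE→Ô ⊚ OL→OE

record PsiOperator {p : ℕ} {F : LocalField p} {LT : LubinTate F} {C : AlgebraicClosure LT}
                   {X : LubinTateCharacter C} {B : BaseField X} {P : Perfection B}
                   {𝕎 : WittRings P} {U : LubinTateElement 𝕎} (E : CoefficientRings U) : Set₁ where
  open LocalField F
  open CoefficientRings E
  private
    module OL = Ops OL
    module Ô  = Ops Ô
  field
    Ê               : CRing
  private
    module Ê  = Ops Ê
  field
    Ô→Ê             : Hom Ô Ê
    Ê-fractions     : IsFractionField Ô→Ê
    φÊ              : Hom Ê Ê
    φÊ-extends      : φÊ ⊚ Ô→Ê ≗ Ô→Ê ⊚ φO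
    -- Ê has degree q over φ_q(Ê).
    Ê-basis         : Fin q → Ê.Carrier
    Ê-degree        : IsBasis φÊ q Ê-basis
    π⁻¹             : Ê.Carrier
    π⁻¹-inverse     : ⟦ Ô→Ê ⟧ (⟦ OL→Ô ⟧ π) Ê.* π⁻¹ Ê.≈ Ê.1#
    -- IsBasis.trace takes values in the source of φÊ, so that the trace of x as an element of
    -- the subfield φ_q(Ê) is ⟦ φÊ ⟧ (trace x).
    ψ               : Ê.Carrier → Ê.Carrier
    ψ-trace         : ∀ x → ⟦ φÊ ⟧ (ψ x) Ê.≈ π⁻¹ Ê.* ⟦ φÊ ⟧ (IsBasis.trace Ê-degree x)
    -- ψ_q preserves Ô and commutes with GK.
    ψO              : Ô.Carrier → Ô.Carrier
    ψO-restricts    : ∀ x → ⟦ Ô→Ê ⟧ (ψO x) Ê.≈ ψ (⟦ Ô→Ê ⟧ x)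
    ψO-commutes     : ∀ σ x → ψO (⟦ gO σ ⟧ x) Ô.≈ ⟦ gO σ ⟧ (ψO x)

    q/π             : OL.Carrier
    q/π-quotient    : π OL.* q/π OL.≈ OL.fromℕ q

Ab : Set₁
Ab = AbelianGroup 0ℓ 0ℓ

record GroupHom (G H : Ab) : Set where
  private
    module G = AbelianGroup G
    module H = AbelianGroup H
  field
    apply               : G.Carrier → H.Carrier
    isGroupHomomorphism : IsGroupHomomorphism G.rawGroup H.rawGroup apply
  open IsGroupHomomorphism isGroupHomomorphism public

open GroupHom public using (apply)

module _ {G H : Ab} where
  private
    module G = AbelianGroup G
    module H = AbelianGroup H
  open Algebra.Properties.AbelianGroup H using (identityˡ-unique; inverseˡ-unique)

  groupHom : (f : G.Carrier → H.Carrier) → (∀ {x y} → x G.≈ y → f x H.≈ f y) →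
             (∀ x y → f (x G.∙ y) H.≈ f x H.∙ f y) → GroupHom G H
  groupHom f cong homo = record
    { apply = f
    ; isGroupHomomorphism = record
      { isMonoidHomomorphism = record
        { isMagmaHomomorphism = record { isRelHomomorphism = record { cong = cong } ; homo = homo }
        ; ε-homo = ε-homo }
      ; ⁻¹-homo = λ x → inverseˡ-unique (f (x G.⁻¹)) (f x)
          (H.trans (H.sym (homo _ _)) (H.trans (cong (G.inverseˡ x)) ε-homo)) } }
    where
      ε-homo : f G.ε H.≈ H.ε
      ε-homo = identityˡ-unique (f G.ε) (f G.ε) (H.trans (H.sym (homo _ _)) (cong (G.identityˡ G.ε)))

-- The direct sum of a finite family, as the group of sections.
Sections : (I : Set) → (I → Ab) → Ab
Sections I G = record
  { Carrier = ∀ i → Carrier (G i)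
  ; _≈_ = λ x y → ∀ i → _≈_ (G i) (x i) (y i)
  ; _∙_ = λ x y i → _∙_ (G i) (x i) (y i)
  ; ε = λ i → ε (G i)
  ; _⁻¹ = λ x i → _⁻¹ (G i) (x i)
  ; isAbelianGroup = record
    { isGroup = record
      { isMonoid = record
        { isSemigroup = record
          { isMagma = record
            { isEquivalence = record
              { refl = λ i → refl (G i) ; sym = λ p i → sym (G i) (p i) ; trans = λ p q i → trans (G i) (p i) (q i) }
            ; ∙-cong = λ p q i → ∙-cong (G i) (p i) (q i) }
          ; assoc = λ x y z i → assoc (G i) (x i) (y i) (z i) }
        ; identity = (λ x i → identityˡ (G i) (x i)) , (λ x i → identityʳ (G i) (x i)) }
      ; inverse = (λ x i → inverseˡ (G i) (x i)) , (λ x i → inverseʳ (G i) (x i))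
      ; ⁻¹-cong = λ p i → ⁻¹-cong (G i) (p i) }
    ; comm = λ x y i → comm (G i) (x i) (y i) } }
  where open AbelianGroup

record Complex : Set₁ where
  field
    X  : ℕ → Ab
    d  : ∀ n → GroupHom (X n) (X (suc n))
    d² : ∀ n x → AbelianGroup._≈_ (X (suc (suc n))) (apply (d (suc n)) (apply (d n) x)) (AbelianGroup.ε (X (suc (suc n))))

record ComplexHom (C D : Complex) : Set where
  private
    module C = Complex C
    module D = Complex D
  field
    map      : ∀ n → GroupHom (C.X n) (D.X n)
    commutes : ∀ n x → AbelianGroup._≈_ (D.X (suc n)) (apply (D.d n) (apply (map n) x)) (apply (map (suc n)) (apply (C.d n) x))

module Cohomology (C : Complex) where
  open Complex C

  IsCocycle : ∀ n → AbelianGroup.Carrier (X n) → Set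
  IsCocycle n x = AbelianGroup._≈_ (X (suc n)) (apply (d n) x) (AbelianGroup.ε (X (suc n)))

  IsCoboundary : ∀ n → AbelianGroup.Carrier (X n) → Set
  IsCoboundary zero    x = AbelianGroup._≈_ (X 0) x (AbelianGroup.ε (X 0))
  IsCoboundary (suc n) x = ∃[ w ] AbelianGroup._≈_ (X (suc n)) (apply (d n) w) x

  private
    module _ {n : ℕ} where
      open AbelianGroup (X n)
      open Algebra.Properties.AbelianGroup (X n)
      open Algebra.Properties.CommutativeSemigroup commutativeSemigroup using (interchange)
      open Relation.Binary.Reasoning.Setoid setoid

      ε-cob : ∀ m → IsCoboundary m (AbelianGroup.ε (X m))
      ε-cob zero    = AbelianGroup.refl (X 0)
      ε-cob (suc m) = AbelianGroup.ε (X m) , GroupHom.ε-homo (d m)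

      resp-cob : ∀ m {x y} → AbelianGroup._≈_ (X m) x y → IsCoboundary m x → IsCoboundary m y
      resp-cob zero    x≈y b       = AbelianGroup.trans (X 0) (AbelianGroup.sym (X 0) x≈y) b
      resp-cob (suc m) x≈y (w , b) = w , AbelianGroup.trans (X (suc m)) b x≈y

      ∙-cob : ∀ m {x y} → IsCoboundary m x → IsCoboundary m y → IsCoboundary m (AbelianGroup._∙_ (X m) x y)
      ∙-cob zero    b c = AbelianGroup.trans (X 0) (AbelianGroup.∙-cong (X 0) b c) (AbelianGroup.identityˡ (X 0) _)
      ∙-cob (suc m) (w , b) (z , c) = AbelianGroup._∙_ (X m) w z ,
        AbelianGroup.trans (X (suc m)) (GroupHom.homo (d m) w z) (AbelianGroup.∙-cong (X (suc m)) b c)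

      ⁻¹-cob : ∀ m {x} → IsCoboundary m x → IsCoboundary m (AbelianGroup._⁻¹ (X m) x)
      ⁻¹-cob zero    b = AbelianGroup.trans (X 0) (AbelianGroup.⁻¹-cong (X 0) b)
                           (Algebra.Properties.AbelianGroup.ε⁻¹≈ε (X 0))
      ⁻¹-cob (suc m) (w , b) = AbelianGroup._⁻¹ (X m) w ,
        AbelianGroup.trans (X (suc m)) (GroupHom.⁻¹-homo (d m) w) (AbelianGroup.⁻¹-cong (X (suc m)) b)

      ≈-cob : ∀ {x y} → x ≈ y → IsCoboundary n (x - y)
      ≈-cob x≈y = resp-cob n (sym (trans (∙-congʳ x≈y) (inverseʳ _))) (ε-cob n)

      sym-eq : ∀ x y → (x - y) ⁻¹ ≈ y - x
      sym-eq x y = begin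
        (x - y) ⁻¹          ≈⟨ ⁻¹-∙-comm x (y ⁻¹) ⟨
        x ⁻¹ ∙ y ⁻¹ ⁻¹      ≈⟨ ∙-congˡ (⁻¹-involutive y) ⟩
        x ⁻¹ ∙ y            ≈⟨ comm _ _ ⟩
        y - x               ∎

      trans-eq : ∀ x y z → (x - y) ∙ (y - z) ≈ x - z
      trans-eq x y z = begin
        (x - y) ∙ (y - z)         ≈⟨ assoc _ _ _ ⟩
        x ∙ (y ⁻¹ ∙ (y ∙ z ⁻¹))   ≈⟨ ∙-congˡ (assoc _ _ _) ⟨
        x ∙ ((y ⁻¹ ∙ y) ∙ z ⁻¹)   ≈⟨ ∙-congˡ (∙-congʳ (inverseˡ y)) ⟩
        x ∙ (ε ∙ z ⁻¹)            ≈⟨ ∙-congˡ (identityˡ _) ⟩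
        x - z                     ∎

      ∙-eq : ∀ x y z w → (x - y) ∙ (z - w) ≈ (x ∙ z) - (y ∙ w)
      ∙-eq x y z w = trans (interchange x (y ⁻¹) z (w ⁻¹)) (∙-congˡ (⁻¹-∙-comm y w))

  ℋ : ℕ → Ab
  ℋ n = record
    { Carrier = Σ Carrier (IsCocycle n)
    ; _≈_ = λ (x , _) (y , _) → IsCoboundary n (x - y)
    ; _∙_ = λ (x , p) (y , q) → x ∙ y , S.trans (GroupHom.homo (d n) x y) (S.trans (S.∙-cong p q) (S.identityˡ _))
    ; ε = ε , GroupHom.ε-homo (d n)
    ; _⁻¹ = λ (x , p) → x ⁻¹ , S.trans (GroupHom.⁻¹-homo (d n) x) (S.trans (S.⁻¹-cong p) (Algebra.Properties.AbelianGroup.ε⁻¹≈ε (X (suc n))))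
    ; isAbelianGroup = record
      { isGroup = record
        { isMonoid = record
          { isSemigroup = record
            { isMagma = record
              { isEquivalence = record
                { refl = ≈-cob refl
                ; sym = λ {(x , _)} {(y , _)} b → resp-cob {n} n (sym-eq x y) (⁻¹-cob {n} n b)
                ; trans = λ {(x , _)} {(y , _)} {(z , _)} b c → resp-cob {n} n (trans-eq x y z) (∙-cob {n} n b c) }
              ; ∙-cong = λ {(x , _)} {(y , _)} {(z , _)} {(w , _)} b c → resp-cob {n} n (∙-eq x y z w) (∙-cob {n} n b c) }
            ; assoc = λ (x , _) (y , _) (z , _) → ≈-cob (assoc x y z) }
          ; identity = (λ (x , _) → ≈-cob (identityˡ x)) , (λ (x , _) → ≈-cob (identityʳ x)) }
        ; inverse = (λ (x , _) → ≈-cob (inverseˡ x)) , (λ (x , _) → ≈-cob (inverseʳ x))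
        ; ⁻¹-cong = λ {(x , _)} {(y , _)} b → resp-cob {n} n (sym (⁻¹-∙-comm x (y ⁻¹))) (⁻¹-cob {n} n b) }
      ; comm = λ (x , _) (y , _) → ≈-cob (comm x y) } }
    where
      open AbelianGroup (X n)
      open Algebra.Properties.AbelianGroup (X n)
      module S = AbelianGroup (X (suc n))

open Cohomology public using (ℋ)

record DoubleComplex : Set₁ where
  field
    X     : ℕ → ℕ → Ab
    dʰ    : ∀ r s → GroupHom (X r s) (X (suc r) s)
    dᵛ    : ∀ r s → GroupHom (X r s) (X r (suc s))
    dʰ²   : ∀ r s x → AbelianGroup._≈_ (X (suc (suc r)) s) (apply (dʰ (suc r) s) (apply (dʰ r s) x)) (AbelianGroup.ε (X (suc (suc r)) s))
    dᵛ²   : ∀ r s x → AbelianGroup._≈_ (X r (suc (suc s))) (apply (dᵛ r (suc s)) (apply (dᵛ r s) x)) (AbelianGroup.ε (X r (suc (suc s))))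
    dʰdᵛ  : ∀ r s x → AbelianGroup._≈_ (X (suc r) (suc s)) (apply (dʰ r (suc s)) (apply (dᵛ r s) x)) (apply (dᵛ (suc r) s) (apply (dʰ r s) x))

-- ± n x = (-1) ^ n x
module Sign (A : Ab) where
  open AbelianGroup A
  open Algebra.Properties.AbelianGroup A

  ± : ℕ → Carrier → Carrier
  ± zero    x = x
  ± (suc n) x = (± n x) ⁻¹

  ±-cong : ∀ n {x y} → x ≈ y → ± n x ≈ ± n y
  ±-cong zero    p = p
  ±-cong (suc n) p = ⁻¹-cong (±-cong n p)

  ±-homo : ∀ n x y → ± n (x ∙ y) ≈ ± n x ∙ ± n y
  ±-homo zero    x y = refl
  ±-homo (suc n) x y = trans (⁻¹-cong (±-homo n x y)) (sym (⁻¹-∙-comm _ _))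

  ±-ε : ∀ n → ± n ε ≈ ε
  ±-ε zero    = refl
  ±-ε (suc n) = trans (⁻¹-cong (±-ε n)) ε⁻¹≈ε

±-hom : ∀ {G H : Ab} (f : GroupHom G H) n x →
        AbelianGroup._≈_ H (apply f (Sign.± G n x)) (Sign.± H n (apply f x))
±-hom {H = H} f zero    x = AbelianGroup.refl H
±-hom {H = H} f (suc n) x = AbelianGroup.trans H (GroupHom.⁻¹-homo f _) (AbelianGroup.⁻¹-cong H (±-hom f n x))

TotIndex : ℕ → Set
TotIndex n = Σ[ r ∈ ℕ ] Σ[ s ∈ ℕ ] r ℕ.+ s ≡ n

-- The total complex, with differential dʰ + (-1) ^ r dᵛ on X r s.
module _ (D : DoubleComplex) where
  open DoubleComplex D
  private
    module A r s = AbelianGroup (X r s)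

  TotX : ℕ → Ab
  TotX n = Sections (TotIndex n) (λ (r , s , _) → X r s)

  private
    pred-index : ∀ {n} r s → suc r ℕ.+ suc s ≡ suc n → suc r ℕ.+ s ≡ n
    pred-index r s e = ≡.trans (≡.sym (ℕ.+-suc r s)) (ℕ.suc-injective e)

  totd : ∀ n → AbelianGroup.Carrier (TotX n) → AbelianGroup.Carrier (TotX (suc n))
  totd n x (zero  , suc s , e) = apply (dᵛ 0 s) (x (0 , s , ℕ.suc-injective e))
  totd n x (suc r , zero  , e) = apply (dʰ r 0) (x (r , 0 , ℕ.suc-injective e))
  totd n x (suc r , suc s , e) = A._∙_ (suc r) (suc s)
    (apply (dʰ r (suc s)) (x (r , suc s , ℕ.suc-injective e)))
    (Sign.± (X (suc r) (suc s)) (suc r) (apply (dᵛ (suc r) s) (x (suc r , s , pred-index r s e))))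

  private
    totd-cong : ∀ n {x y} → AbelianGroup._≈_ (TotX n) x y → AbelianGroup._≈_ (TotX (suc n)) (totd n x) (totd n y)
    totd-cong n p (zero  , suc s , e) = GroupHom.⟦⟧-cong (dᵛ 0 s) (p _)
    totd-cong n p (suc r , zero  , e) = GroupHom.⟦⟧-cong (dʰ r 0) (p _)
    totd-cong n p (suc r , suc s , e) = A.∙-cong (suc r) (suc s) (GroupHom.⟦⟧-cong (dʰ r (suc s)) (p _))
      (Sign.±-cong (X (suc r) (suc s)) (suc r) (GroupHom.⟦⟧-cong (dᵛ (suc r) s) (p _)))

    totd-homo : ∀ n x y → AbelianGroup._≈_ (TotX (suc n)) (totd n (AbelianGroup._∙_ (TotX n) x y))
                          (AbelianGroup._∙_ (TotX (suc n)) (totd n x) (totd n y))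
    totd-homo n x y (zero  , suc s , e) = GroupHom.homo (dᵛ 0 s) _ _
    totd-homo n x y (suc r , zero  , e) = GroupHom.homo (dʰ r 0) _ _
    totd-homo n x y (suc r , suc s , e) = trans
      (∙-cong (GroupHom.homo (dʰ r (suc s)) _ _)
        (trans (Sign.±-cong G (suc r) (GroupHom.homo (dᵛ (suc r) s) _ _)) (Sign.±-homo G (suc r) _ _)))
      (interchange _ _ _ _)
      where
        G : Ab
        G = X (suc r) (suc s)
        open AbelianGroup G
        open Algebra.Properties.CommutativeSemigroup commutativeSemigroup using (interchange)

  TotD : ∀ n → GroupHom (TotX n) (TotX (suc n))
  TotD n = groupHom (totd n) (λ {x} {y} → totd-cong n {x} {y}) (totd-homo n)

  private
    module _ (n : ℕ) (x : AbelianGroup.Carrier (TotX n)) where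
      irr : ∀ {r s} (e e′ : r ℕ.+ s ≡ n) → A._≈_ r s (x (r , s , e)) (x (r , s , e′))
      irr {r} {s} e e′ = A.reflexive r s (≡.cong (λ e → x (r , s , e)) (ℕ.≡-irrelevant e e′))

      square : ∀ r s (e e′ : r ℕ.+ s ≡ n) → A._≈_ (suc r) (suc s)
        (A._∙_ (suc r) (suc s)
          (apply (dʰ r (suc s)) (Sign.± (X r (suc s)) r (apply (dᵛ r s) (x (r , s , e)))))
          (Sign.± (X (suc r) (suc s)) (suc r) (apply (dᵛ (suc r) s) (apply (dʰ r s) (x (r , s , e′))))))
        (A.ε (suc r) (suc s))
      square r s e e′ = begin
        apply (dʰ r (suc s)) (Sign.± (X r (suc s)) r (apply (dᵛ r s) (x (r , s , e)))) ∙ b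
          ≈⟨ ∙-congʳ (±-hom (dʰ r (suc s)) r _) ⟩
        ± r (apply (dʰ r (suc s)) (apply (dᵛ r s) (x (r , s , e)))) ∙ b
          ≈⟨ ∙-congʳ (±-cong r (trans (dʰdᵛ r s _) (GroupHom.⟦⟧-cong (dᵛ (suc r) s) (GroupHom.⟦⟧-cong (dʰ r s) (irr e e′))))) ⟩
        ± r (apply (dᵛ (suc r) s) (apply (dʰ r s) (x (r , s , e′)))) ∙ b
          ≈⟨ inverseʳ _ ⟩
        ε ∎
        where
          open AbelianGroup (X (suc r) (suc s))
          open Sign (X (suc r) (suc s))
          open Relation.Binary.Reasoning.Setoid setoid
          b : Carrier
          b = ± (suc r) (apply (dᵛ (suc r) s) (apply (dʰ r s) (x (r , s , e′))))

      totd² : AbelianGroup._≈_ (TotX (suc (suc n))) (totd (suc n) (totd n x)) (AbelianGroup.ε (TotX (suc (suc n))))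
      totd² (zero , suc zero , ())
      totd² (zero , suc (suc s) , e) = dᵛ² 0 s _
      totd² (suc zero , zero , ())
      totd² (suc (suc r) , zero , e) = dʰ² r 0 _
      totd² (suc zero , suc zero , e) = square 0 0 _ _
      totd² (suc (suc r) , suc zero , e) = begin
        apply (dʰ (suc r) 1) (apply (dʰ r 1) _ ∙₁ Sign.± (X (suc r) 1) (suc r) (apply (dᵛ (suc r) 0) _)) ∙ b
          ≈⟨ ∙-congʳ (trans (GroupHom.homo (dʰ (suc r) 1) _ _) (trans (∙-congʳ (dʰ² r 1 _)) (identityˡ _))) ⟩
        apply (dʰ (suc r) 1) (Sign.± (X (suc r) 1) (suc r) (apply (dᵛ (suc r) 0) _)) ∙ b
          ≈⟨ square (suc r) 0 _ _ ⟩
        ε ∎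
        where
          open AbelianGroup (X (suc (suc r)) 1)
          open AbelianGroup (X (suc r) 1) using () renaming (_∙_ to _∙₁_)
          open Relation.Binary.Reasoning.Setoid setoid
          b : Carrier
          b = Sign.± (X (suc (suc r)) 1) (suc (suc r)) (apply (dᵛ (suc (suc r)) 0) (apply (dʰ (suc r) 0) _))
      totd² (suc zero , suc (suc s) , e) = begin
        a ∙ ± 1 (apply (dᵛ 1 (suc s)) (apply (dʰ 0 (suc s)) _ ∙₁ Sign.± (X 1 (suc s)) 1 (apply (dᵛ 1 s) _)))
          ≈⟨ ∙-congˡ (±-cong 1 (trans (GroupHom.homo (dᵛ 1 (suc s)) _ _) (trans (∙-congˡ
               (trans (±-hom (dᵛ 1 (suc s)) 1 _) (trans (±-cong 1 (dᵛ² 1 s _)) (±-ε 1)))) (identityʳ _)))) ⟩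
        a ∙ ± 1 (apply (dᵛ 1 (suc s)) (apply (dʰ 0 (suc s)) _))
          ≈⟨ square 0 (suc s) _ _ ⟩
        ε ∎
        where
          open AbelianGroup (X 1 (suc (suc s)))
          open AbelianGroup (X 1 (suc s)) using () renaming (_∙_ to _∙₁_)
          open Sign (X 1 (suc (suc s)))
          open Relation.Binary.Reasoning.Setoid setoid
          a : Carrier
          a = apply (dʰ 0 (suc (suc s))) (apply (dᵛ 0 (suc s)) _)
      totd² (suc (suc r) , suc (suc s) , e) = begin
        apply (dʰ (suc r) (suc (suc s))) (apply (dʰ r (suc (suc s))) _ ∙₂ Sign.± (X (suc r) (suc (suc s))) (suc r) (apply (dᵛ (suc r) (suc s)) _))
          ∙ ± R (apply (dᵛ R (suc s)) (apply (dʰ (suc r) (suc s)) _ ∙₁ Sign.± (X R (suc s)) R (apply (dᵛ R s) _)))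
          ≈⟨ ∙-cong (trans (GroupHom.homo (dʰ (suc r) (suc (suc s))) _ _) (trans (∙-congʳ (dʰ² r (suc (suc s)) _)) (identityˡ _)))
               (±-cong R (trans (GroupHom.homo (dᵛ R (suc s)) _ _) (trans (∙-congˡ
                 (trans (±-hom (dᵛ R (suc s)) R _) (trans (±-cong R (dᵛ² R s _)) (±-ε R)))) (identityʳ _)))) ⟩
        apply (dʰ (suc r) (suc (suc s))) (Sign.± (X (suc r) (suc (suc s))) (suc r) (apply (dᵛ (suc r) (suc s)) _))
          ∙ ± R (apply (dᵛ R (suc s)) (apply (dʰ (suc r) (suc s)) _))
          ≈⟨ square (suc r) (suc s) _ _ ⟩
        ε ∎
        where
          R : ℕ
          R = suc (suc r)
          open AbelianGroup (X R (suc (suc s)))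
          open AbelianGroup (X R (suc s)) using () renaming (_∙_ to _∙₁_)
          open AbelianGroup (X (suc r) (suc (suc s))) using () renaming (_∙_ to _∙₂_)
          open Sign (X R (suc (suc s)))
          open Relation.Binary.Reasoning.Setoid setoid

  Tot : Complex
  Tot = record { X = TotX ; d = TotD ; d² = totd² }

-- below j S = # { i ∈ S : i < j }
below : ∀ {n} → Fin n → Subset n → ℕ
below zero    S       = 0
below (suc j) (b ∷ S) = (if b then 1 else 0) ℕ.+ below j S

idᴳ : ∀ {G : Ab} → GroupHom G G
idᴳ {G} = groupHom id id (λ _ _ → AbelianGroup.refl G)

module _ {G H : Ab} where
  open AbelianGroup H
  open Algebra.Properties.AbelianGroup H using (⁻¹-∙-comm)
  open Algebra.Properties.CommutativeSemigroup commutativeSemigroup using (interchange)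

  infixl 6 _⊖_
  _⊖_ : GroupHom G H → GroupHom G H → GroupHom G H
  f ⊖ g = groupHom (λ x → apply f x - apply g x)
    (λ p → ∙-cong (GroupHom.⟦⟧-cong f p) (⁻¹-cong (GroupHom.⟦⟧-cong g p)))
    (λ x y → trans (∙-cong (GroupHom.homo f x y) (trans (⁻¹-cong (GroupHom.homo g x y)) (sym (⁻¹-∙-comm _ _))))
                   (interchange _ _ _ _))

Commute : {G : Ab} → GroupHom G G → GroupHom G G → Set
Commute {G} f g = ∀ x → AbelianGroup._≈_ G (apply f (apply g x)) (apply g (apply f x))

module _ {G : Ab} where
  open AbelianGroup G

  commute-⊖ : (h f g : GroupHom G G) → Commute h f → Commute h g → Commute h (f ⊖ g)
  commute-⊖ h f g hf hg x = trans (GroupHom.homo h _ _)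
    (∙-cong (hf x) (trans (GroupHom.⁻¹-homo h _) (⁻¹-cong (hg x))))

  commute-sym : (f g : GroupHom G G) → Commute f g → Commute g f
  commute-sym f g p x = sym (p x)

  commute-id : (f : GroupHom G G) → Commute f idᴳ
  commute-id f x = refl

-- The Koszul differential of operators δ j on A, on the sum of all degrees.
module KoszulSum (A : Ab) where
  open AbelianGroup A
  open Algebra.Properties.CommutativeMonoid.Sum commutativeMonoid using (sum; sum-cong-≋; ∑-distrib-+; sum-replicate-zero)
  open Sign A
  open Algebra.Properties.AbelianGroup A
  open Algebra.Properties.CommutativeSemigroup commutativeSemigroup using (interchange)

  -- The contribution of S = T ∖ j to the component at T; note # { i ∈ T : i < j } = # { i ∈ S : i < j }.
  koszulTerm : ∀ {n} → (Fin n → GroupHom A A) → (Subset n → Carrier) → Subset n → Fin n → Carrier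
  koszulTerm δ x T j = if lookup T j then ± (below j T) (apply (δ j) (x (T ∖ j))) else ε

  koszul : ∀ {n} → (Fin n → GroupHom A A) → (Subset n → Carrier) → Subset n → Carrier
  koszul δ x T = sum (koszulTerm δ x T)

  private
    if-cong : ∀ b {x y} → x ≈ y → (if b then x else ε) ≈ (if b then y else ε)
    if-cong true  p = p
    if-cong false p = refl

  koszul-cong : ∀ {n} (δ : Fin n → GroupHom A A) x y → (∀ S → x S ≈ y S) → ∀ T → koszul δ x T ≈ koszul δ y T
  koszul-cong δ x y p T = sum-cong-≋ (λ j → if-cong (lookup T j) (±-cong (below j T) (GroupHom.⟦⟧-cong (δ j) (p _))))

  koszul-homo : ∀ {n} (δ : Fin n → GroupHom A A) x y T →
                koszul δ (λ S → x S ∙ y S) T ≈ koszul δ x T ∙ koszul δ y T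
  koszul-homo {n} δ x y T = trans (sum-cong-≋ lemma) (∑-distrib-+ {n} _ _)
    where
      lemma : ∀ j → koszulTerm δ (λ S → x S ∙ y S) T j ≈ koszulTerm δ x T j ∙ koszulTerm δ y T j
      lemma j with lookup T j
      ... | true  = trans (±-cong (below j T) (GroupHom.homo (δ j) _ _)) (±-homo (below j T) _ _)
      ... | false = sym (identityˡ ε)

  koszul-ε : ∀ {n} (δ : Fin n → GroupHom A A) x → (∀ S → x S ≈ ε) → ∀ T → koszul δ x T ≈ ε
  koszul-ε {n} δ x p T = trans (sum-cong-≋ lemma) (sum-replicate-zero n)
    where
      lemma : ∀ j → koszulTerm δ x T j ≈ ε
      lemma j with lookup T j
      ... | true  = trans (±-cong (below j T) (trans (GroupHom.⟦⟧-cong (δ j) (p _)) (GroupHom.ε-homo (δ j)))) (±-ε (below j T))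
      ... | false = refl

  koszul-⁻¹ : ∀ {n} (δ : Fin n → GroupHom A A) x T → koszul δ (λ S → x S ⁻¹) T ≈ (koszul δ x T) ⁻¹
  koszul-⁻¹ δ x T = inverseˡ-unique _ _
    (trans (sym (koszul-homo δ (λ S → x S ⁻¹) x T)) (koszul-ε δ _ (λ S → inverseˡ (x S)) T))

  private
    sum-hom : ∀ {n} (f : GroupHom A A) (t : Fin n → Carrier) → apply f (sum t) ≈ sum (apply f ∘ t)
    sum-hom {zero}  f t = GroupHom.ε-homo f
    sum-hom {suc n} f t = trans (GroupHom.homo f _ _) (∙-congˡ (sum-hom f (t ∘ suc)))

    sum-⁻¹ : ∀ {n} (t : Fin n → Carrier) → sum (λ j → t j ⁻¹) ≈ sum t ⁻¹
    sum-⁻¹ {zero}  t = sym ε⁻¹≈ε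
    sum-⁻¹ {suc n} t = trans (∙-congˡ (sum-⁻¹ (t ∘ suc))) (⁻¹-∙-comm _ _)

  koszul-hom : ∀ {n} (f : GroupHom A A) (δ : Fin n → GroupHom A A) → (∀ j → Commute f (δ j)) →
               ∀ x T → apply f (koszul δ x T) ≈ koszul δ (apply f ∘ x) T
  koszul-hom f δ com x T = trans (sum-hom f (koszulTerm δ x T)) (sum-cong-≋ lemma)
    where
      lemma : ∀ j → apply f (koszulTerm δ x T j) ≈ koszulTerm δ (apply f ∘ x) T j
      lemma j with lookup T j
      ... | true  = trans (±-hom f (below j T) _) (±-cong (below j T) (com j _))
      ... | false = GroupHom.ε-homo f

  private
    koszul-out : ∀ {n} (δ : Fin (suc n) → GroupHom A A) x T →
                 koszul δ x (outside ∷ T) ≈ koszul (δ ∘ suc) (x ∘ (outside ∷_)) T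
    koszul-out δ x T = identityˡ _

    koszul-in : ∀ {n} (δ : Fin (suc n) → GroupHom A A) x T →
                koszul δ x (inside ∷ T) ≈ apply (δ zero) (x (outside ∷ T)) - koszul (δ ∘ suc) (x ∘ (inside ∷_)) T
    koszul-in {n} δ x T = ∙-cong (GroupHom.⟦⟧-cong (δ zero) (reflexive (≡.cong (λ S → x (outside ∷ S)) (p─⊥≡p T))))
      (trans (sum-cong-≋ lemma) (sum-⁻¹ (koszulTerm (δ ∘ suc) (x ∘ (inside ∷_)) T)))
      where
        lemma : ∀ j → koszulTerm δ x (inside ∷ T) (suc j) ≈ koszulTerm (δ ∘ suc) (x ∘ (inside ∷_)) T j ⁻¹
        lemma j with lookup T j
        ... | true  = refl
        ... | false = sym ε⁻¹≈ε

  koszul² : ∀ {n} (δ : Fin n → GroupHom A A) → (∀ i j → Commute (δ i) (δ j)) →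
            ∀ x T → koszul δ (koszul δ x) T ≈ ε
  koszul² {zero}  δ com x [] = refl
  koszul² {suc n} δ com x (outside ∷ T) = begin
    koszul δ (koszul δ x) (outside ∷ T)    ≈⟨ koszul-out δ (koszul δ x) T ⟩
    koszul δ′ (koszul δ x ∘ (outside ∷_)) T ≈⟨ koszul-cong δ′ _ (koszul δ′ (x ∘ (outside ∷_))) (koszul-out δ x) T ⟩
    koszul δ′ (koszul δ′ (x ∘ (outside ∷_))) T ≈⟨ koszul² δ′ (λ i j → com (suc i) (suc j)) (x ∘ (outside ∷_)) T ⟩
    ε ∎
    where
      open Relation.Binary.Reasoning.Setoid setoid
      δ′ : Fin n → GroupHom A A
      δ′ = δ ∘ suc
  koszul² {suc n} δ com x (inside ∷ T) = begin
    koszul δ (koszul δ x) (inside ∷ T)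
      ≈⟨ koszul-in δ (koszul δ x) T ⟩
    apply δ₀ (koszul δ x (outside ∷ T)) - koszul δ′ (koszul δ x ∘ (inside ∷_)) T
      ≈⟨ ∙-cong (GroupHom.⟦⟧-cong δ₀ (koszul-out δ x T)) (⁻¹-cong (koszul-cong δ′ (koszul δ x ∘ (inside ∷_)) (λ S → apply δ₀ (xₒ S) - koszul δ′ xᵢ S) (koszul-in δ x) T)) ⟩
    apply δ₀ (koszul δ′ xₒ T) - koszul δ′ (λ S → apply δ₀ (xₒ S) - koszul δ′ xᵢ S) T
      ≈⟨ ∙-cong (koszul-hom δ₀ δ′ (λ j → com zero (suc j)) xₒ T) (⁻¹-cong (trans (koszul-homo δ′ (apply δ₀ ∘ xₒ) (λ S → koszul δ′ xᵢ S ⁻¹) T)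
           (trans (∙-congˡ (trans (koszul-⁻¹ δ′ (koszul δ′ xᵢ) T) (trans (⁻¹-cong (koszul² δ′ (λ i j → com (suc i) (suc j)) xᵢ T)) ε⁻¹≈ε))) (identityʳ _)))) ⟩
    koszul δ′ (apply δ₀ ∘ xₒ) T - koszul δ′ (apply δ₀ ∘ xₒ) T
      ≈⟨ inverseʳ _ ⟩
    ε ∎
    where
      open Relation.Binary.Reasoning.Setoid setoid
      δ₀ : GroupHom A A
      δ₀ = δ zero
      δ′ : Fin n → GroupHom A A
      δ′ = δ ∘ suc
      xₒ xᵢ : Subset n → Carrier
      xₒ = x ∘ (outside ∷_)
      xᵢ = x ∘ (inside ∷_)

∣S∖j∣ : ∀ {n} (S : Subset n) j → lookup S j ≡ true → ∣ S ∣ ≡ suc ∣ S ∖ j ∣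
∣S∖j∣ (inside  ∷ S) zero    e = ≡.cong (suc ∘ ∣_∣) (≡.sym (p─⊥≡p S))
∣S∖j∣ (inside  ∷ S) (suc j) e = ≡.cong suc (∣S∖j∣ S j e)
∣S∖j∣ (outside ∷ S) (suc j) e = ∣S∖j∣ S j e

KoszulIndex : ℕ → ℕ → Set
KoszulIndex n r = Σ[ S ∈ Subset n ] ∣ S ∣ ≡ r

-- The Koszul complex of A for commuting operators γ j: the degree r term is the direct sum of
-- copies of A over the subsets of size r.
module _ {n : ℕ} (A : Ab) (γ : Fin n → GroupHom A A) where
  open AbelianGroup A
  open KoszulSum A

  KoszulX : ℕ → Ab
  KoszulX r = Sections (KoszulIndex n r) (λ _ → A)

  -- Extension by zero to all subsets.
  extend : ∀ r → AbelianGroup.Carrier (KoszulX r) → Subset n → Carrier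
  extend r x S with ∣ S ∣ ≟ r
  ... | yes e = x (S , e)
  ... | no  _ = ε

  extend-cong : ∀ r x y → AbelianGroup._≈_ (KoszulX r) x y → ∀ S → extend r x S ≈ extend r y S
  extend-cong r x y p S with ∣ S ∣ ≟ r
  ... | yes e = p (S , e)
  ... | no  _ = refl

  extend-homo : ∀ r x y S → extend r (AbelianGroup._∙_ (KoszulX r) x y) S ≈ extend r x S ∙ extend r y S
  extend-homo r x y S with ∣ S ∣ ≟ r
  ... | yes e = refl
  ... | no  _ = sym (identityˡ ε)

  private
    δ : Fin n → GroupHom A A
    δ j = γ j ⊖ idᴳ

  KoszulD : ∀ r → GroupHom (KoszulX r) (KoszulX (suc r))
  KoszulD r = groupHom (λ x (T , _) → koszul δ (extend r x) T)
    (λ {x} {y} p (T , _) → koszul-cong δ (extend r x) (extend r y) (extend-cong r x y p) T)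
    (λ x y (T , _) → trans (koszul-cong δ _ _ (extend-homo r x y) T) (koszul-homo δ (extend r x) (extend r y) T))

  private
    extend-D : ∀ r x S → extend (suc r) (apply (KoszulD r) x) S ≈ koszul δ (extend r x) S
    extend-D r x S with ∣ S ∣ ≟ suc r
    ... | yes e = refl
    ... | no ∣S∣≢ = sym (trans (sum-cong-≋ lemma) (sum-replicate-zero n))
      where
        open Algebra.Properties.CommutativeMonoid.Sum commutativeMonoid using (sum; sum-cong-≋; sum-replicate-zero)
        open Sign A
        lemma : ∀ j → koszulTerm δ (extend r x) S j ≈ ε
        lemma j with lookup S j in j∈S
        ... | false = refl
        ... | true with ∣ S ∖ j ∣ ≟ r
        ...   | yes e = contradiction (≡.trans (∣S∖j∣ S j j∈S) (≡.cong suc e)) ∣S∣≢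
        ...   | no  _ = trans (±-cong (below j S) (GroupHom.ε-homo (δ j))) (±-ε (below j S))

  module _ (γ-comm : ∀ i j → Commute (γ i) (γ j)) where
    private
      δ-comm : ∀ i j → Commute (δ i) (δ j)
      δ-comm i j = commute-⊖ (δ i) (γ j) idᴳ
        (commute-sym (γ j) (δ i) (commute-⊖ (γ j) (γ i) idᴳ (γ-comm j i) (commute-id (γ j))))
        (commute-id (δ i))

    KoszulD² : ∀ r x → AbelianGroup._≈_ (KoszulX (suc (suc r))) (apply (KoszulD (suc r)) (apply (KoszulD r) x))
                                        (AbelianGroup.ε (KoszulX (suc (suc r))))
    KoszulD² r x (T , _) = trans (koszul-cong δ _ (koszul δ (extend r x)) (extend-D r x) T) (koszul² δ δ-comm (extend r x) T)

-- A complex with commuting operators γ j.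
record OperatorComplex (n : ℕ) : Set₁ where
  field
    complex : Complex
  open Complex complex public
  field
    γ       : Fin n → ∀ s → GroupHom (X s) (X s)
    γ-comm  : ∀ i j s → Commute (γ i s) (γ j s)
    γ-d     : ∀ j s x → AbelianGroup._≈_ (X (suc s)) (apply (γ j (suc s)) (apply (d s) x)) (apply (d s) (apply (γ j s) x))

-- The double complex obtained by applying the Koszul complex to each term.
module _ {n : ℕ} (C : OperatorComplex n) where
  open OperatorComplex C

  KoszulDouble : DoubleComplex
  KoszulDouble = record
    { X = λ r s → KoszulX (X s) (λ j → γ j s) r
    ; dʰ = λ r s → KoszulD (X s) (λ j → γ j s) r
    ; dᵛ = λ r s → groupHom (λ x i → apply (d s) (x i)) (λ p i → GroupHom.⟦⟧-cong (d s) (p i)) (λ x y i → GroupHom.homo (d s) _ _)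
    ; dʰ² = λ r s → KoszulD² (X s) (λ j → γ j s) (λ i j → γ-comm i j s) r
    ; dᵛ² = λ r s x i → d² s (x i)
    ; dʰdᵛ = λ r s x (T , e) → natural r s x T }
    where
      module _ (r s : ℕ) (x : AbelianGroup.Carrier (KoszulX (X s) (λ j → γ j s) r)) where
        open AbelianGroup (X (suc s))
        open Algebra.Properties.CommutativeMonoid.Sum commutativeMonoid using (sum-cong-≋)
        open Algebra.Properties.CommutativeMonoid.Sum (AbelianGroup.commutativeMonoid (X s)) using () renaming (sum to sumₛ)
        open Sign (X (suc s))
        private
          module K′ = KoszulSum (X s)
          module K = KoszulSum (X (suc s))
        γₛ : Fin n → GroupHom (X s) (X s)
        γₛ j = γ j s
        γₛ₊₁ : Fin n → GroupHom (X (suc s)) (X (suc s))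
        γₛ₊₁ j = γ j (suc s)

        sum-d : ∀ {m} (t : Fin m → AbelianGroup.Carrier (X s)) → apply (d s) (sumₛ t) ≈ Algebra.Properties.CommutativeMonoid.Sum.sum commutativeMonoid (apply (d s) ∘ t)
        sum-d {zero}  t = GroupHom.ε-homo (d s)
        sum-d {suc m} t = trans (GroupHom.homo (d s) _ _) (∙-congˡ (sum-d (t ∘ suc)))

        extend-d : ∀ S → extend (X (suc s)) γₛ₊₁ r (λ i → apply (d s) (x i)) S ≈ apply (d s) (extend (X s) γₛ r x S)
        extend-d S with ∣ S ∣ ≟ r
        ... | yes _ = refl
        ... | no  _ = sym (GroupHom.ε-homo (d s))

        diff-d : ∀ j y → apply (γₛ₊₁ j ⊖ idᴳ) (apply (d s) y) ≈ apply (d s) (apply (γₛ j ⊖ idᴳ) y)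
        diff-d j y = sym (trans (GroupHom.homo (d s) _ _) (∙-cong (sym (γ-d j s y)) (GroupHom.⁻¹-homo (d s) y)))

        natural : ∀ T → K.koszul (λ j → γₛ₊₁ j ⊖ idᴳ) (extend (X (suc s)) γₛ₊₁ r (λ i → apply (d s) (x i))) T
                      ≈ apply (d s) (K′.koszul (λ j → γₛ j ⊖ idᴳ) (extend (X s) γₛ r x) T)
        natural T = trans (K.koszul-cong (λ j → γₛ₊₁ j ⊖ idᴳ) _ (apply (d s) ∘ extend (X s) γₛ r x) extend-d T)
          (trans (sum-cong-≋ term) (sym (sum-d (K′.koszulTerm (λ j → γₛ j ⊖ idᴳ) (extend (X s) γₛ r x) T))))
          where
            term : ∀ j → K.koszulTerm (λ j → γₛ₊₁ j ⊖ idᴳ) (apply (d s) ∘ extend (X s) γₛ r x) T j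
                       ≈ apply (d s) (K′.koszulTerm (λ j → γₛ j ⊖ idᴳ) (extend (X s) γₛ r x) T j)
            term j with lookup T j
            ... | true  = trans (±-cong (below j T) (diff-d j _)) (sym (±-hom (d s) (below j T) _))
            ... | false = sym (GroupHom.ε-homo (d s))

  TotKoszul : Complex
  TotKoszul = Tot KoszulDouble

-- The morphism g of total complexes is f on each summand.
IsInducedBy : ∀ {n} {C D : OperatorComplex n} →
              ComplexHom (OperatorComplex.complex C) (OperatorComplex.complex D) →
              ComplexHom (TotKoszul C) (TotKoszul D) → Set
IsInducedBy {n} {C} {D} f g =
  ∀ m (x : AbelianGroup.Carrier (Complex.X (TotKoszul C) m)) r s (e : r ℕ.+ s ≡ m) (S : KoszulIndex n r) →
  AbelianGroup._≈_ (OperatorComplex.X D s) (apply (ComplexHom.map g m) x (r , s , e) S)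
                                           (apply (ComplexHom.map f s) (x (r , s , e) S))

-- The maps h send the class of x to the class of its image.
IsInducedOnCohomology : ∀ {C D} → ComplexHom C D → (∀ i → GroupHom (ℋ C i) (ℋ D i)) → Set
IsInducedOnCohomology {C} {D} g h =
  ∀ i x (dx≈0 : Cohomology.IsCocycle C i x) →
  Σ[ dgx≈0 ∈ Cohomology.IsCocycle D i (apply (ComplexHom.map g i) x) ]
  AbelianGroup._≈_ (ℋ D i) (apply (h i) (x , dx≈0)) (apply (ComplexHom.map g i) x , dgx≈0)

-- The complex f : A → A in degrees 0 and 1.
module _ {n : ℕ} (A : Ab) (γ : Fin n → GroupHom A A) (γ-comm : ∀ i j → Commute (γ i) (γ j))
         (f : GroupHom A A) (γ-f : ∀ j → Commute (γ j) f) where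

  private
    𝟎 : Ab
    𝟎 = Algebra.Construct.Terminal.abelianGroup

    Xₙ : ℕ → Ab
    Xₙ 0             = A
    Xₙ 1             = A
    Xₙ (suc (suc _)) = 𝟎

    trivial : ∀ {G : Ab} → GroupHom G 𝟎
    trivial = groupHom _ _ _

    dₙ : ∀ m → GroupHom (Xₙ m) (Xₙ (suc m))
    dₙ zero    = f
    dₙ (suc m) = trivial

    γₙ : Fin n → ∀ m → GroupHom (Xₙ m) (Xₙ m)
    γₙ j 0             = γ j
    γₙ j 1             = γ j
    γₙ j (suc (suc m)) = trivial

    γₙ-comm : ∀ i j m → Commute (γₙ i m) (γₙ j m)
    γₙ-comm i j 0             = γ-comm i j
    γₙ-comm i j 1             = γ-comm i j
    γₙ-comm i j (suc (suc m)) = _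

    γₙ-d : ∀ j s x → AbelianGroup._≈_ (Xₙ (suc s)) (apply (γₙ j (suc s)) (apply (dₙ s) x)) (apply (dₙ s) (apply (γₙ j s) x))
    γₙ-d j zero    = γ-f j
    γₙ-d j (suc s) = _

    dₙ² : ∀ m x → AbelianGroup._≈_ (Xₙ (suc (suc m))) (apply (dₙ (suc m)) (apply (dₙ m) x)) (AbelianGroup.ε (Xₙ (suc (suc m))))
    dₙ² m = _

  twoTerm : OperatorComplex n
  twoTerm = record
    { complex = record { X = Xₙ ; d = dₙ ; d² = dₙ² }
    ; γ = γₙ ; γ-comm = γₙ-comm ; γ-d = γₙ-d }

Mod : CRing → Set₁
Mod A = LeftModule (CommutativeRing.ring A) 0ℓ 0ℓ

selfModule : (A : CRing) → Mod A
selfModule A = Algebra.Module.Construct.TensorUnit.leftModule {R = CommutativeRing.ring A}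

restrictScalars : {A B : CRing} → Hom A B → Mod B → Mod A
restrictScalars f M = record
  { Carrierᴹ = Carrierᴹ ; _≈ᴹ_ = _≈ᴹ_ ; _+ᴹ_ = _+ᴹ_ ; _*ₗ_ = λ a → ⟦ f ⟧ a *ₗ_ ; 0ᴹ = 0ᴹ ; -ᴹ_ = -ᴹ_
  ; isLeftModule = record
    { isLeftSemimodule = record
      { +ᴹ-isCommutativeMonoid = +ᴹ-isCommutativeMonoid
      ; isPreleftSemimodule = record
        { *ₗ-cong = λ p q → *ₗ-cong (Hom.⟦⟧-cong f p) q
        ; *ₗ-zeroˡ = λ x → ≈ᴹ-trans (*ₗ-congʳ (Hom.0#-homo f)) (*ₗ-zeroˡ x)
        ; *ₗ-distribʳ = λ x a b → ≈ᴹ-trans (*ₗ-congʳ (Hom.+-homo f a b)) (*ₗ-distribʳ x _ _)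
        ; *ₗ-identityˡ = λ x → ≈ᴹ-trans (*ₗ-congʳ (Hom.1#-homo f)) (*ₗ-identityˡ x)
        ; *ₗ-assoc = λ a b x → ≈ᴹ-trans (*ₗ-congʳ (Hom.*-homo f a b)) (*ₗ-assoc _ _ x)
        ; *ₗ-zeroʳ = λ a → *ₗ-zeroʳ _
        ; *ₗ-distribˡ = λ a x y → *ₗ-distribˡ _ x y } }
    ; -ᴹ‿cong = -ᴹ‿cong
    ; -ᴹ‿inverse = -ᴹ‿inverse } }
  where open LeftModule M

record LinearMap (A : CRing) (M N : Mod A) : Set where
  private
    module M = LeftModule M
    module N = LeftModule N
  field
    on     : M.Carrierᴹ → N.Carrierᴹ
    cong   : ∀ {x y} → x M.≈ᴹ y → on x N.≈ᴹ on y
    add    : ∀ x y → on (x M.+ᴹ y) N.≈ᴹ on x N.+ᴹ on y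
    linear : ∀ a x → on (a M.*ₗ x) N.≈ᴹ a N.*ₗ on x

  zero-homo : on M.0ᴹ N.≈ᴹ N.0ᴹ
  zero-homo = N.≈ᴹ-trans (cong (M.≈ᴹ-sym (M.*ₗ-zeroˡ M.0ᴹ))) (N.≈ᴹ-trans (linear _ _) (N.*ₗ-zeroˡ _))

open LinearMap public using (on)

idLinear : (A : CRing) (M : Mod A) → LinearMap A M M
idLinear A M = record { on = id ; cong = id ; add = λ _ _ → ≈ᴹ-refl ; linear = λ _ _ → ≈ᴹ-refl }
  where open LeftModule M

-- The elements of M ⊗ N are formal sums of pairs, up to the relations of the tensor product.
module Tensor (A : CRing) (M N : Mod A) where
  private
    module M = LeftModule M
    module N = LeftModule N

  Formal : Set
  Formal = List (M.Carrierᴹ × N.Carrierᴹ)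

  infix 4 _~_
  data _~_ : Formal → Formal → Set where
    ~-refl  : ∀ {s} → s ~ s
    ~-sym   : ∀ {s t} → s ~ t → t ~ s
    ~-trans : ∀ {s t u} → s ~ t → t ~ u → s ~ u
    ++-cong : ∀ {s s′ t t′} → s ~ s′ → t ~ t′ → s ++ t ~ s′ ++ t′
    ++-comm : ∀ s t → s ++ t ~ t ++ s
    pair    : ∀ {x x′ y y′} → x M.≈ᴹ x′ → y N.≈ᴹ y′ → (x , y) ∷ [] ~ (x′ , y′) ∷ []
    zeroˡ   : ∀ y → (M.0ᴹ , y) ∷ [] ~ []
    addˡ    : ∀ x x′ y → (x M.+ᴹ x′ , y) ∷ [] ~ (x , y) ∷ (x′ , y) ∷ []
    addʳ    : ∀ x y y′ → (x , y N.+ᴹ y′) ∷ [] ~ (x , y) ∷ (x , y′) ∷ []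
    balance : ∀ a x y → (a M.*ₗ x , y) ∷ [] ~ (x , a N.*ₗ y) ∷ []

module _ {A : CRing} {M N M′ N′ : Mod A} where
  private
    module T  = Tensor A M N
    module T′ = Tensor A M′ N′
    module M′ = LeftModule M′
    module N′ = LeftModule N′
  open T′ using (~-refl; ~-sym; ~-trans; ++-cong; ++-comm; pair; zeroˡ; addˡ; addʳ; balance)

  tensorMap : (LeftModule.Carrierᴹ M → M′.Carrierᴹ) → (LeftModule.Carrierᴹ N → N′.Carrierᴹ) → T.Formal → T′.Formal
  tensorMap f g = List.map (λ (x , y) → f x , g y)

  infixr 7 _⊗_
  _⊗_ : LinearMap A M M′ → LinearMap A N N′ → T.Formal → T′.Formal
  f ⊗ g = tensorMap (on f) (on g)

  ⊗-++ : ∀ f g s t → (f ⊗ g) (s ++ t) ≡ (f ⊗ g) s ++ (f ⊗ g) t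
  ⊗-++ f g = List.map-++ (λ (x , y) → on f x , on g y)

  ⊗-cong : ∀ f g {s t} → s T.~ t → (f ⊗ g) s T′.~ (f ⊗ g) t
  ⊗-cong f g T.~-refl        = ~-refl
  ⊗-cong f g (T.~-sym p)     = ~-sym (⊗-cong f g p)
  ⊗-cong f g (T.~-trans p q) = ~-trans (⊗-cong f g p) (⊗-cong f g q)
  ⊗-cong f g (T.++-cong {s} {s′} {t} {t′} p q)
    rewrite ⊗-++ f g s t | ⊗-++ f g s′ t′ = ++-cong (⊗-cong f g p) (⊗-cong f g q)
  ⊗-cong f g (T.++-comm s t) rewrite ⊗-++ f g s t | ⊗-++ f g t s = ++-comm ((f ⊗ g) s) ((f ⊗ g) t)
  ⊗-cong f g (T.pair p q)    = pair (LinearMap.cong f p) (LinearMap.cong g q)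
  ⊗-cong f g (T.zeroˡ y)     = ~-trans (pair (LinearMap.zero-homo f) N′.≈ᴹ-refl) (zeroˡ _)
  ⊗-cong f g (T.addˡ x x′ y) = ~-trans (pair (LinearMap.add f x x′) N′.≈ᴹ-refl) (addˡ _ _ _)
  ⊗-cong f g (T.addʳ x y y′) = ~-trans (pair M′.≈ᴹ-refl (LinearMap.add g y y′)) (addʳ _ _ _)
  ⊗-cong f g (T.balance a x y) = ~-trans (pair (LinearMap.linear f a x) N′.≈ᴹ-refl)
    (~-trans (balance a _ _) (pair M′.≈ᴹ-refl (N′.≈ᴹ-sym (LinearMap.linear g a y))))

-- (φ_q,Γ_LT)-modules over OE, without the continuity of the action of Γ_LT.
record ΦΓModule {p : ℕ} {F : LocalField p} {LT : LubinTate F} {C : AlgebraicClosure LT}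
                {X : LubinTateCharacter C} {B : BaseField X} {P : Perfection B}
                {𝕎 : WittRings P} {U : LubinTateElement 𝕎} (E : CoefficientRings U) : Set₁ where
  open AlgebraicClosure C using (L∞)
  open LubinTateCharacter X using (GK)
  open CoefficientRings E
  field
    module-OE      : Mod OE
  open LeftModule module-OE public
  field
    φ              : Carrierᴹ → Carrierᴹ
    φ-cong         : ∀ {x y} → x ≈ᴹ y → φ x ≈ᴹ φ y
    φ-add          : ∀ x y → φ (x +ᴹ y) ≈ᴹ φ x +ᴹ φ y
    φ-semilinear   : ∀ a x → φ (a *ₗ x) ≈ᴹ ⟦ φE ⟧ a *ₗ φ x

    -- The action of Γ_LT, the quotient of GK by agreement on L∞.
    act            : GK → Carrierᴹ → Carrierᴹ
    act-cong       : ∀ σ {x y} → x ≈ᴹ y → act σ x ≈ᴹ act σ y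
    act-agree      : ∀ σ τ → AgreeOn L∞ σ τ → ∀ x → act σ x ≈ᴹ act τ x
    act-id         : ∀ x → act idAut x ≈ᴹ x
    act-∘          : ∀ σ τ x → act (σ ∘ₐ τ) x ≈ᴹ act σ (act τ x)
    act-add        : ∀ σ x y → act σ (x +ᴹ y) ≈ᴹ act σ x +ᴹ act σ y
    act-semilinear : ∀ σ a x → act σ (a *ₗ x) ≈ᴹ ⟦ gE σ ⟧ a *ₗ act σ x
    act-φ          : ∀ σ x → act σ (φ x) ≈ᴹ φ (act σ x)

module _ {p : ℕ} {F : LocalField p} {LT : LubinTate F} {C : AlgebraicClosure LT}
         {X : LubinTateCharacter C} {B : BaseField X} {P : Perfection B}
         {𝕎 : WittRings P} {U : LubinTateElement 𝕎} (E : CoefficientRings U) where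
  open LocalField F using (π)
  open AlgebraicClosure C using (L∞)
  open LubinTateCharacter X using (GK)
  open WittRings 𝕎
  open LubinTateElement U
  open CoefficientRings E
  private
    module OE = Ops OE
    module wf = Ops WF.ring

  -- The weak topology of OE, with neighbourhoods π ^ n OE + X ^ n W(k)_L[[X]] of 0.
  WeakOE : ℕ → OE.Carrier → Set
  WeakOE n a = ∃[ b ] ∃[ y ] (PowerSeriesIn-u y ×
    ⟦ OE→WF ⟧ a wf.≈ ⟦ OE→WF ⟧ (⟦ OL→OE ⟧ π OE.^ n OE.* b) wf.+ uF wf.^ n wf.* ⟦ WR→WF ⟧ y)

  -- π-power torsion étale (φ_q,Γ_LT)-modules.
  record IsTorsionÉtale (M : ΦΓModule E) : Set where
    open ΦΓModule M
    open Algebra.Properties.CommutativeMonoid.Sum +ᴹ-commutativeMonoid using (sum)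

    -- The map M ⊗_{OE,φ_q} OE → M.
    linearization : Tensor.Formal OE module-OE (restrictScalars φE (selfModule OE)) → Carrierᴹ
    linearization = foldr (λ (x , a) y → a *ₗ φ x +ᴹ y) 0ᴹ

    open Tensor OE module-OE (restrictScalars φE (selfModule OE)) using (_~_)

    field
      size                     : ℕ
      generators               : Fin size → Carrierᴹ
      finite                   : ∀ x → Σ[ c ∈ (Fin size → OE.Carrier) ] x ≈ᴹ sum (λ i → c i *ₗ generators i)
      torsion                  : ∃[ n ] (∀ x → ⟦ OL→OE ⟧ π OE.^ n *ₗ x ≈ᴹ 0ᴹ)
      linearization-injective  : ∀ {s t} → linearization s ≈ᴹ linearization t → s ~ t
      linearization-surjective : ∀ x → ∃[ t ] linearization t ≈ᴹ x

    -- The topology of M as a quotient of OE ^ size.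
    Near : ℕ → Carrierᴹ → Carrierᴹ → Set
    Near n x y = Σ[ c ∈ (Fin size → OE.Carrier) ]
                 ((∀ i → WeakOE n (c i)) × x ≈ᴹ y +ᴹ sum (λ i → c i *ₗ generators i))

    field
      continuous               : ∀ σ x n → ∃[ xs ] ∃[ m ] (All L∞ xs ×
                                 (∀ τ y → AgreeOnList xs τ σ → Near m y x → Near n (act τ y) (act σ x)))

  record ΦΓHom (M N : ΦΓModule E) : Set where
    private
      module M = ΦΓModule M
      module N = ΦΓModule N
    field
      linearMap : LinearMap OE M.module-OE N.module-OE
      φ-homo    : ∀ x → on linearMap (M.φ x) N.≈ᴹ N.φ (on linearMap x)
      act-homo  : ∀ σ x → on linearMap (M.act σ x) N.≈ᴹ N.act σ (on linearMap x)
    open LinearMap linearMap public using () renaming (on to ⟪_⟫)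

  -- M is a filtered direct limit of π-power torsion étale (φ_q,Γ_LT)-modules.
  record IsLimitOfTorsionÉtale (M : ΦΓModule E) : Set₁ where
    private
      module M = ΦΓModule M
    field
      I               : Set
      _≤_             : I → I → Set
      ≤-refl          : ∀ {i} → i ≤ i
      ≤-trans         : ∀ {i j k} → i ≤ j → j ≤ k → i ≤ k
      inhabited       : I
      directed        : ∀ i j → ∃[ k ] (i ≤ k × j ≤ k)
      stage           : I → ΦΓModule E
      stage-étale     : ∀ i → IsTorsionÉtale (stage i)
      transition      : ∀ {i j} → i ≤ j → ΦΓHom (stage i) (stage j)
      transition-refl : ∀ {i} (i≤i : i ≤ i) x → ΦΓModule._≈ᴹ_ (stage i) (ΦΓHom.⟪_⟫ (transition i≤i) x) x
      transition-comp : ∀ {i j k} (i≤j : i ≤ j) (j≤k : j ≤ k) (i≤k : i ≤ k) x →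
                        ΦΓModule._≈ᴹ_ (stage k) (ΦΓHom.⟪_⟫ (transition j≤k) (ΦΓHom.⟪_⟫ (transition i≤j) x))
                                                (ΦΓHom.⟪_⟫ (transition i≤k) x)
      to-limit        : ∀ i → ΦΓHom (stage i) M
      cocone          : ∀ {i j} (i≤j : i ≤ j) x →
                        ΦΓHom.⟪_⟫ (to-limit j) (ΦΓHom.⟪_⟫ (transition i≤j) x) M.≈ᴹ ΦΓHom.⟪_⟫ (to-limit i) x
      exhausted       : ∀ x → ∃[ i ] ∃[ y ] ΦΓHom.⟪_⟫ (to-limit i) y M.≈ᴹ x
      identified      : ∀ i x y → ΦΓHom.⟪_⟫ (to-limit i) x M.≈ᴹ ΦΓHom.⟪_⟫ (to-limit i) y →
                        ∃[ j ] Σ[ i≤j ∈ i ≤ j ]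
                        ΦΓModule._≈ᴹ_ (stage j) (ΦΓHom.⟪_⟫ (transition i≤j) x) (ΦΓHom.⟪_⟫ (transition i≤j) y)

-- Discrete π-primary OL-linear representations of GK.
record Representation {p : ℕ} {F : LocalField p} {LT : LubinTate F} {C : AlgebraicClosure LT}
                      (X : LubinTateCharacter C) : Set₁ where
  open LocalField F
  open AlgebraicClosure C using (Ω)
  open LubinTateCharacter X using (GK)
  private
    module OL = Ops OL
    module Ω  = Ops Ω
  field
    module-OL : Mod OL
  open LeftModule module-OL public
  field
    g         : GK → LinearMap OL module-OL module-OL
    g-id      : ∀ x → on (g idAut) x ≈ᴹ x
    g-∘       : ∀ σ τ x → on (g (σ ∘ₐ τ)) x ≈ᴹ on (g σ) (on (g τ) x)
    discrete  : ∀ x → Σ[ as ∈ List Ω.Carrier ] (∀ σ → AgreeOnList as σ idAut → on (g σ) x ≈ᴹ x)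
    primary   : ∀ x → ∃[ n ] π OL.^ n *ₗ x ≈ᴹ 0ᴹ

-- Ô as an OL-module, with φ_q and the action of GK.
module CoefficientModule {p : ℕ} {F : LocalField p} {LT : LubinTate F} {C : AlgebraicClosure LT}
                         {X : LubinTateCharacter C} {B : BaseField X} {P : Perfection B}
                         {𝕎 : WittRings P} {U : LubinTateElement 𝕎} (E : CoefficientRings U) where
  open LocalField F
  open AlgebraicClosure C
  open LubinTateCharacter X
  open WittRings 𝕎
  open CoefficientRings E
  private
    module OL = Ops OL
    module Ô  = CommutativeRing Ô
    module WFR = CommutativeRing WF.ring

  private
    OL-fixed : (h : Hom WF.ring WF.ring) (f : Hom Ô Ô) → h ⊚ WF.right ≗ WF.right → Ô→WF ⊚ f ≗ h ⊚ Ô→WF →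
               f ⊚ OL→Ô ≗ OL→Ô
    OL-fixed h f h-fix f-res a = Ô-injective (begin
      ⟦ Ô→WF ⟧ (⟦ f ⟧ (⟦ OL→Ô ⟧ a)) ≈⟨ f-res _ ⟩
      ⟦ h ⟧ (⟦ Ô→WF ⟧ (⟦ OL→Ô ⟧ a)) ≈⟨ Hom.⟦⟧-cong h (image a) ⟩
      ⟦ h ⟧ (⟦ WF.right ⟧ a)         ≈⟨ h-fix a ⟩
      ⟦ WF.right ⟧ a                 ≈⟨ image a ⟨
      ⟦ Ô→WF ⟧ (⟦ OL→Ô ⟧ a)          ∎)
      where
        open Relation.Binary.Reasoning.Setoid WFR.setoid
        image : ∀ a → ⟦ Ô→WF ⟧ (⟦ OL→Ô ⟧ a) WFR.≈ ⟦ WF.right ⟧ a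
        image a = WFR.trans (OE→Ô-inclusion _) (OL→OE-inclusion a)

  Ô-OL : Mod OL
  Ô-OL = restrictScalars OL→Ô (selfModule Ô)

  private
    asLinear : (f : Hom Ô Ô) → f ⊚ OL→Ô ≗ OL→Ô → LinearMap OL Ô-OL Ô-OL
    asLinear f fix = record
      { on = ⟦ f ⟧ ; cong = Hom.⟦⟧-cong f ; add = Hom.+-homo f
      ; linear = λ a x → Ô.trans (Hom.*-homo f _ x) (Ô.*-congʳ (fix a)) }

  φ-Ô : LinearMap OL Ô-OL Ô-OL
  φ-Ô = asLinear φO (OL-fixed φW φO φW-right φO-restricts)

  g-Ô : GK → LinearMap OL Ô-OL Ô-OL
  g-Ô σ = asLinear (gO σ) (OL-fixed (gW σ) (gO σ) (gW-right σ) (gO-restricts σ))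

  multiplication : Ô.Carrier → LinearMap OL Ô-OL Ô-OL
  multiplication b = record
    { on = b Ô.*_ ; cong = Ô.*-congˡ ; add = Ô.distribˡ b
    ; linear = λ a x → Ô.trans (Ô.sym (Ô.*-assoc _ _ _)) (Ô.trans (Ô.*-congʳ (Ô.*-comm _ _)) (Ô.*-assoc _ _ _)) }

-- An isomorphism of M with 𝔻_LT(V) = (Ô ⊗ V)^HK.
record IsDLT {p : ℕ} {F : LocalField p} {LT : LubinTate F} {C : AlgebraicClosure LT}
             {X : LubinTateCharacter C} {B : BaseField X} {P : Perfection B}
             {𝕎 : WittRings P} {U : LubinTateElement 𝕎} {E : CoefficientRings U}
             (M : ΦΓModule E) (V : Representation X) : Set where
  open LocalField F using (OL)
  open LubinTateCharacter X using (GK; HK)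
  open CoefficientRings E
  open CoefficientModule E
  private
    module M = ΦΓModule M
    module V = Representation V
  open Tensor OL Ô-OL V.module-OL using (Formal; _~_)

  g⊗ : GK → Formal → Formal
  g⊗ σ = g-Ô σ ⊗ V.g σ

  field
    iso        : M.Carrierᴹ → Formal
    cong       : ∀ {x y} → x M.≈ᴹ y → iso x ~ iso y
    add        : ∀ x y → iso (x M.+ᴹ y) ~ iso x ++ iso y
    linear     : ∀ a x → iso (a M.*ₗ x) ~ (multiplication (⟦ OE→Ô ⟧ a) ⊗ idLinear OL V.module-OL) (iso x)
    φ-homo     : ∀ x → iso (M.φ x) ~ (φ-Ô ⊗ idLinear OL V.module-OL) (iso x)
    act-homo   : ∀ σ x → iso (M.act σ x) ~ g⊗ σ (iso x)
    injective  : ∀ {x y} → iso x ~ iso y → x M.≈ᴹ y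
    invariant  : ∀ x σ → HK σ → g⊗ σ (iso x) ~ iso x
    surjective : ∀ t → (∀ σ → HK σ → g⊗ σ t ~ t) → ∃[ x ] iso x ~ t

module _ {A B : CRing} {f : Hom A B} {n : ℕ} {b : Fin n → CommutativeRing.Carrier B} (basis : IsBasis f n b) where
  open IsBasis basis
  private
    module A where
      open CommutativeRing A public
      open Algebra.Properties.Semiring.Sum semiring public
    module B where
      open CommutativeRing B public
      open Algebra.Properties.Semiring.Sum semiring public

  basis-injective : Fin n → Injective f
  basis-injective i {x} {x′} fx≈fx′ =
    A.trans (unique y (λ _ → x) B.refl i)
            (A.sym (unique y (λ _ → x′) (B.sum-cong-≋ {n} (λ j → B.*-congʳ {b j} fx≈fx′)) i))
    where
      y : B.Carrier
      y = B.sum (λ j → ⟦ f ⟧ x B.* b j)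

  coord-cong : ∀ {y y′} → y B.≈ y′ → ∀ i → coord y i A.≈ coord y′ i
  coord-cong y≈y′ = unique _ _ (B.trans (B.sym y≈y′) (expand _))

  coord-add : ∀ y y′ i → coord (y B.+ y′) i A.≈ coord y i A.+ coord y′ i
  coord-add y y′ i = A.sym (unique _ _ (B.trans (B.+-cong (expand y) (expand y′))
    (B.trans (B.sym (B.∑-distrib-+ {n} _ _))
      (B.sum-cong-≋ {n} (λ j → B.trans (B.sym (B.distribʳ _ _ _)) (B.*-congʳ (B.sym (Hom.+-homo f _ _))))))) i)

  coord-scale : ∀ a y i → coord (⟦ f ⟧ a B.* y) i A.≈ a A.* coord y i
  coord-scale a y i = A.sym (unique _ _ (B.trans (B.*-congˡ (expand y)) (B.trans (B.*-distribˡ-sum {n} _ _)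
    (B.sum-cong-≋ {n} (λ j → B.trans (B.sym (B.*-assoc _ _ _)) (B.*-congʳ (B.sym (Hom.*-homo f _ _))))))) i)

  trace-cong : ∀ {y y′} → y B.≈ y′ → trace y A.≈ trace y′
  trace-cong p = A.sum-cong-≋ {n} (λ i → coord-cong (B.*-congʳ p) i)

  trace-add : ∀ y y′ → trace (y B.+ y′) A.≈ trace y A.+ trace y′
  trace-add y y′ = A.trans (A.sum-cong-≋ {n} (λ i → A.trans (coord-cong (B.distribʳ _ _ _) i) (coord-add _ _ i)))
                           (A.∑-distrib-+ {n} _ _)

  trace-scale : ∀ a y → trace (⟦ f ⟧ a B.* y) A.≈ a A.* trace y
  trace-scale a y = A.trans (A.sum-cong-≋ {n} (λ i → A.trans (coord-cong (B.*-assoc _ _ _) i) (coord-scale a _ i)))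
                            (A.sym (A.*-distribˡ-sum {n} a _))

module _ {p : ℕ} {F : LocalField p} {LT : LubinTate F} {C : AlgebraicClosure LT}
         {X : LubinTateCharacter C} {B : BaseField X} {P : Perfection B}
         {𝕎 : WittRings P} {U : LubinTateElement 𝕎} {E : CoefficientRings U}
         (Ψ : PsiOperator E) where
  open LocalField F
  open CoefficientRings E
  open CoefficientModule E
  open PsiOperator Ψ
  private
    module kL = CommutativeRing kL
    module Ô = CommutativeRing Ô
    module Ê where
      open CommutativeRing Ê public
      open import Algebra.Properties.CommutativeSemigroup *-commutativeSemigroup public using (x∙yz≈y∙xz)

    φÊ-injective : Injective φÊ
    φÊ-injective = basis-injective Ê-degree (Inverse.from kL-cardinality kL.0#)

    ψ-cong : ∀ {x y} → x Ê.≈ y → ψ x Ê.≈ ψ y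
    ψ-cong x≈y = φÊ-injective (Ê.trans (ψ-trace _) (Ê.trans
      (Ê.*-congˡ (Hom.⟦⟧-cong φÊ (trace-cong Ê-degree x≈y))) (Ê.sym (ψ-trace _))))

    ψ-add : ∀ x y → ψ (x Ê.+ y) Ê.≈ ψ x Ê.+ ψ y
    ψ-add x y = φÊ-injective (begin
      ⟦ φÊ ⟧ (ψ (x Ê.+ y))
        ≈⟨ ψ-trace _ ⟩
      π⁻¹ Ê.* ⟦ φÊ ⟧ (trace (x Ê.+ y))
        ≈⟨ Ê.*-congˡ (Ê.trans (Hom.⟦⟧-cong φÊ (trace-add Ê-degree x y)) (Hom.+-homo φÊ _ _)) ⟩
      π⁻¹ Ê.* (⟦ φÊ ⟧ (trace x) Ê.+ ⟦ φÊ ⟧ (trace y))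
        ≈⟨ Ê.distribˡ _ _ _ ⟩
      π⁻¹ Ê.* ⟦ φÊ ⟧ (trace x) Ê.+ π⁻¹ Ê.* ⟦ φÊ ⟧ (trace y)
        ≈⟨ Ê.+-cong (ψ-trace x) (ψ-trace y) ⟨
      ⟦ φÊ ⟧ (ψ x) Ê.+ ⟦ φÊ ⟧ (ψ y)
        ≈⟨ Hom.+-homo φÊ _ _ ⟨
      ⟦ φÊ ⟧ (ψ x Ê.+ ψ y) ∎)
      where
        open Relation.Binary.Reasoning.Setoid Ê.setoid
        open IsBasis Ê-degree using (trace)

    ψ-scale : ∀ a x → ⟦ φÊ ⟧ a Ê.≈ a → ψ (a Ê.* x) Ê.≈ a Ê.* ψ x
    ψ-scale a x φa≈a = φÊ-injective (begin
      ⟦ φÊ ⟧ (ψ (a Ê.* x))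
        ≈⟨ ψ-trace _ ⟩
      π⁻¹ Ê.* ⟦ φÊ ⟧ (trace (a Ê.* x))
        ≈⟨ Ê.*-congˡ (Hom.⟦⟧-cong φÊ (trace-cong Ê-degree (Ê.*-congʳ (Ê.sym φa≈a)))) ⟩
      π⁻¹ Ê.* ⟦ φÊ ⟧ (trace (⟦ φÊ ⟧ a Ê.* x))
        ≈⟨ Ê.*-congˡ (Ê.trans (Hom.⟦⟧-cong φÊ (trace-scale Ê-degree a x)) (Hom.*-homo φÊ _ _)) ⟩
      π⁻¹ Ê.* (⟦ φÊ ⟧ a Ê.* ⟦ φÊ ⟧ (trace x))
        ≈⟨ Ê.x∙yz≈y∙xz _ _ _ ⟩
      ⟦ φÊ ⟧ a Ê.* (π⁻¹ Ê.* ⟦ φÊ ⟧ (trace x))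
        ≈⟨ Ê.*-congˡ (ψ-trace x) ⟨
      ⟦ φÊ ⟧ a Ê.* ⟦ φÊ ⟧ (ψ x)
        ≈⟨ Hom.*-homo φÊ _ _ ⟨
      ⟦ φÊ ⟧ (a Ê.* ψ x) ∎)
      where
        open Relation.Binary.Reasoning.Setoid Ê.setoid
        open IsBasis Ê-degree using (trace)

    Ô→Ê-injective : Injective Ô→Ê
    Ô→Ê-injective = IsFractionField.injective Ê-fractions

    OL-fixed-φÊ : ∀ a → ⟦ φÊ ⟧ (⟦ Ô→Ê ⟧ (⟦ OL→Ô ⟧ a)) Ê.≈ ⟦ Ô→Ê ⟧ (⟦ OL→Ô ⟧ a)
    OL-fixed-φÊ a = Ê.trans (φÊ-extends _) (Hom.⟦⟧-cong Ô→Ê (Ô.trans (Hom.⟦⟧-cong φO (Ô.sym (Ô.*-identityʳ _)))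
      (Ô.trans (LinearMap.linear φ-Ô a Ô.1#) (Ô.trans (Ô.*-congˡ (Hom.1#-homo φO)) (Ô.*-identityʳ _)))))

  ψ-Ô : LinearMap OL Ô-OL Ô-OL
  ψ-Ô = record
    { on = ψO
    ; cong = λ p → Ô→Ê-injective (Ê.trans (ψO-restricts _) (Ê.trans (ψ-cong (Hom.⟦⟧-cong Ô→Ê p)) (Ê.sym (ψO-restricts _))))
    ; add = λ x y → Ô→Ê-injective (Ê.trans (ψO-restricts _) (Ê.trans (ψ-cong (Hom.+-homo Ô→Ê x y))
        (Ê.trans (ψ-add _ _) (Ê.trans (Ê.sym (Ê.+-cong (ψO-restricts x) (ψO-restricts y))) (Ê.sym (Hom.+-homo Ô→Ê _ _))))))
    ; linear = λ a x → Ô→Ê-injective (Ê.trans (ψO-restricts _) (Ê.trans (ψ-cong (Hom.*-homo Ô→Ê _ x))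
        (Ê.trans (ψ-scale _ _ (OL-fixed-φÊ a)) (Ê.trans (Ê.sym (Ê.*-congˡ (ψO-restricts x))) (Ê.sym (Hom.*-homo Ô→Ê _ _)))))) }

  module PsiOnModule {M : ΦΓModule E} {V : Representation X} (D : IsDLT M V) where
    open LubinTateCharacter X
    private
      module M = ΦΓModule M
      module V = Representation V
      module D = IsDLT D
    open Tensor OL Ô-OL V.module-OL

    ψ⊗id : Formal → Formal
    ψ⊗id = ψ-Ô ⊗ idLinear OL V.module-OL

    ψ⊗id-g : ∀ σ t → ψ⊗id (D.g⊗ σ t) ~ D.g⊗ σ (ψ⊗id t)
    ψ⊗id-g σ []            = ~-refl
    ψ⊗id-g σ ((x , y) ∷ t) = ++-cong (pair (ψO-commutes σ x) V.≈ᴹ-refl) (ψ⊗id-g σ t)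

    -- ψ_M is the restriction of ψ_q ⊗ id to the HK-invariants.
    private
      ψ-image : ∀ x → ∃[ y ] D.iso y ~ ψ⊗id (D.iso x)
      ψ-image x = D.surjective (ψ⊗id (D.iso x)) (λ σ σ∈HK →
        ~-trans (~-sym (ψ⊗id-g σ (D.iso x))) (⊗-cong ψ-Ô (idLinear OL V.module-OL) (D.invariant x σ σ∈HK)))

    ψM : M.Carrierᴹ → M.Carrierᴹ
    ψM x = proj₁ (ψ-image x)

    ψM-iso : ∀ x → D.iso (ψM x) ~ ψ⊗id (D.iso x)
    ψM-iso x = proj₂ (ψ-image x)

    private
      ψ⊗id-cong : ∀ {s t} → s ~ t → ψ⊗id s ~ ψ⊗id t
      ψ⊗id-cong = ⊗-cong ψ-Ô (idLinear OL V.module-OL)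

      g⊗-cong : ∀ σ {s t} → s ~ t → D.g⊗ σ s ~ D.g⊗ σ t
      g⊗-cong σ = ⊗-cong (g-Ô σ) (V.g σ)

    ψM-cong : ∀ {x y} → x M.≈ᴹ y → ψM x M.≈ᴹ ψM y
    ψM-cong x≈y = D.injective (~-trans (ψM-iso _) (~-trans (ψ⊗id-cong (D.cong x≈y)) (~-sym (ψM-iso _))))

    ψM-add : ∀ x y → ψM (x M.+ᴹ y) M.≈ᴹ ψM x M.+ᴹ ψM y
    ψM-add x y = D.injective (~-trans (ψM-iso _) (~-trans (ψ⊗id-cong (D.add x y)) (~-trans
      (≡.subst (_~ (ψ⊗id (D.iso x) ++ ψ⊗id (D.iso y))) (≡.sym (⊗-++ ψ-Ô (idLinear OL V.module-OL) (D.iso x) (D.iso y))) ~-refl)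
      (~-trans (++-cong (~-sym (ψM-iso x)) (~-sym (ψM-iso y))) (~-sym (D.add _ _))))))

    ψM-act : ∀ σ x → M.act σ (ψM x) M.≈ᴹ ψM (M.act σ x)
    ψM-act σ x = D.injective (~-trans (D.act-homo σ (ψM x)) (~-trans (g⊗-cong σ (ψM-iso x))
      (~-trans (~-sym (ψ⊗id-g σ (D.iso x))) (~-trans (ψ⊗id-cong (~-sym (D.act-homo σ x))) (~-sym (ψM-iso _))))))

-- M^Δ and the operators on it.
module _ {p : ℕ} {F : LocalField p} {LT : LubinTate F} {C : AlgebraicClosure LT}
         {X : LubinTateCharacter C} {B : BaseField X} {P : Perfection B}
         {𝕎 : WittRings P} {U : LubinTateElement 𝕎} {E : CoefficientRings U}
         (M : ΦΓModule E) where
  open LocalField F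
  open AlgebraicClosure C
  open LubinTateCharacter X
  open BaseField B
  open WittRings 𝕎
  open CoefficientRings E
  open ΦΓModule M
  private
    module OL = CommutativeRing OL
    module OE = CommutativeRing OE
    module WFR = CommutativeRing WF.ring

  ΔInvariant : Carrierᴹ → Set
  ΔInvariant x = ∀ δ → Δ δ → act δ x ≈ᴹ x

  act-zero : ∀ σ → act σ 0ᴹ ≈ᴹ 0ᴹ
  act-zero σ = ≈ᴹ-trans (act-cong σ (≈ᴹ-sym (*ₗ-zeroˡ 0ᴹ)))
    (≈ᴹ-trans (act-semilinear σ _ _) (≈ᴹ-trans (*ₗ-congʳ (Hom.0#-homo (gE σ))) (*ₗ-zeroˡ _)))

  act-neg : ∀ σ x → act σ (-ᴹ x) ≈ᴹ -ᴹ act σ x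
  act-neg σ x = uniqueˡ‿-ᴹ _ _ (≈ᴹ-trans (≈ᴹ-sym (act-add σ _ _)) (≈ᴹ-trans (act-cong σ (-ᴹ‿inverseˡ x)) (act-zero σ)))

  _^Δ : Ab
  _^Δ = record
    { Carrier = Σ Carrierᴹ ΔInvariant
    ; _≈_ = λ (x , _) (y , _) → x ≈ᴹ y
    ; _∙_ = λ (x , p) (y , q) → x +ᴹ y , λ δ d → ≈ᴹ-trans (act-add δ x y) (+ᴹ-cong (p δ d) (q δ d))
    ; ε = 0ᴹ , λ δ _ → act-zero δ
    ; _⁻¹ = λ (x , p) → -ᴹ x , λ δ d → ≈ᴹ-trans (act-neg δ x) (-ᴹ‿cong (p δ d))
    ; isAbelianGroup = record
      { isGroup = record
        { isMonoid = record
          { isSemigroup = record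
            { isMagma = record
              { isEquivalence = record { refl = ≈ᴹ-refl ; sym = ≈ᴹ-sym ; trans = ≈ᴹ-trans }
              ; ∙-cong = +ᴹ-cong }
            ; assoc = λ (x , _) (y , _) (z , _) → +ᴹ-assoc x y z }
          ; identity = (λ (x , _) → +ᴹ-identityˡ x) , (λ (x , _) → +ᴹ-identityʳ x) }
        ; inverse = (λ (x , _) → -ᴹ‿inverseˡ x) , (λ (x , _) → -ᴹ‿inverseʳ x)
        ; ⁻¹-cong = -ᴹ‿cong }
      ; comm = λ (x , _) (y , _) → +ᴹ-comm x y } }

  -- An additive endomorphism commuting with Δ, restricted to M^Δ.
  onΔ : (f : Carrierᴹ → Carrierᴹ) → (∀ {x y} → x ≈ᴹ y → f x ≈ᴹ f y) →
        (∀ x y → f (x +ᴹ y) ≈ᴹ f x +ᴹ f y) → (∀ δ → Δ δ → ∀ x → act δ (f x) ≈ᴹ f (act δ x)) →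
        GroupHom _^Δ _^Δ
  onΔ f f-cong f-add f-Δ = groupHom
    (λ (x , p) → f x , λ δ d → ≈ᴹ-trans (f-Δ δ d x) (f-cong (p δ d)))
    f-cong (λ (x , _) (y , _) → f-add x y)

  private
    χK : GK → OL.Carrier
    χK σ = χ (asGL σ)

    χK-mul : ∀ σ τ → χK (σ ∘ₐ τ) OL.≈ χK σ OL.* χK τ
    χK-mul σ τ = OL.trans (Equivalence.from (χ-injective (asGL (σ ∘ₐ τ)) (asGL σ ∘ₐ asGL τ)) (λ _ _ → CommutativeRing.refl Ω))
                          (χ-mul (asGL σ) (asGL τ))

  act-comm : ∀ σ τ x → act σ (act τ x) ≈ᴹ act τ (act σ x)
  act-comm σ τ x = ≈ᴹ-trans (≈ᴹ-sym (act-∘ σ τ x)) (≈ᴹ-trans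
    (act-agree (σ ∘ₐ τ) (τ ∘ₐ σ) (Equivalence.to (χ-injective (asGL (σ ∘ₐ τ)) (asGL (τ ∘ₐ σ)))
      (OL.trans (χK-mul σ τ) (OL.trans (OL.*-comm _ _) (OL.sym (χK-mul τ σ))))) x)
    (act-∘ τ σ x))

  OL-fixed-gE : ∀ σ a → ⟦ gE σ ⟧ (⟦ OL→OE ⟧ a) OE.≈ ⟦ OL→OE ⟧ a
  OL-fixed-gE σ a = OE-injective (begin
    ⟦ OE→WF ⟧ (⟦ gE σ ⟧ (⟦ OL→OE ⟧ a)) ≈⟨ gE-restricts σ _ ⟩
    ⟦ gW σ ⟧ (⟦ OE→WF ⟧ (⟦ OL→OE ⟧ a)) ≈⟨ Hom.⟦⟧-cong (gW σ) (OL→OE-inclusion a) ⟩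
    ⟦ gW σ ⟧ (⟦ WF.right ⟧ a)           ≈⟨ gW-right σ a ⟩
    ⟦ WF.right ⟧ a                      ≈⟨ OL→OE-inclusion a ⟨
    ⟦ OE→WF ⟧ (⟦ OL→OE ⟧ a)             ∎)
    where open Relation.Binary.Reasoning.Setoid WFR.setoid

  act-scale : ∀ σ a x → act σ (⟦ OL→OE ⟧ a *ₗ x) ≈ᴹ ⟦ OL→OE ⟧ a *ₗ act σ x
  act-scale σ a x = ≈ᴹ-trans (act-semilinear σ _ x) (*ₗ-congʳ (OL-fixed-gE σ a))

  φΔ : GroupHom _^Δ _^Δ
  φΔ = onΔ φ φ-cong φ-add (λ δ _ → act-φ δ)

  γΔ : Fin d → GroupHom _^Δ _^Δ
  γΔ j = onΔ (act (γ j)) (act-cong (γ j)) (act-add (γ j)) (λ δ _ → act-comm δ (γ j))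

  scaleΔ : OL.Carrier → GroupHom _^Δ _^Δ
  scaleΔ a = onΔ (⟦ OL→OE ⟧ a *ₗ_) *ₗ-congˡ (*ₗ-distribˡ _) (λ δ _ → act-scale δ a)

  γΔ-comm : ∀ i j → Commute (γΔ i) (γΔ j)
  γΔ-comm i j (x , _) = act-comm (γ i) (γ j) x

  Φ• : OperatorComplex d
  Φ• = twoTerm _^Δ γΔ γΔ-comm (φΔ ⊖ idᴳ) (λ j →
    commute-⊖ (γΔ j) φΔ idᴳ (λ (x , _) → act-φ (γ j) x) (commute-id (γΔ j)))

  ΦΓ• : Complex
  ΦΓ• = TotKoszul Φ•

  module _ (Ψ : PsiOperator E) {V : Representation X} (D : IsDLT M V) where
    open PsiOperator Ψ using (q/π)
    open PsiOnModule Ψ D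

    ψΔ : GroupHom _^Δ _^Δ
    ψΔ = onΔ ψM ψM-cong ψM-add (λ δ _ → ψM-act δ)

    Ψ• : OperatorComplex d
    Ψ• = twoTerm _^Δ γΔ γΔ-comm (ψΔ ⊖ scaleΔ q/π) (λ j →
      commute-⊖ (γΔ j) ψΔ (scaleΔ q/π) (λ (x , _) → ψM-act (γ j) x) (λ (x , _) → act-scale (γ j) q/π x))

    ΨΓ• : Complex
    ΨΓ• = TotKoszul Ψ•

{-# OPTIONS --safe #-}

-- The relation ψ_M ∘ φ_M = (q/π) id gives −ψ_M ∘ (φ_M − id) = ψ_M − (q/π) id, and ψ_M
-- commutes with Γ_LT, so that (id, −ψ_M) passes to the Koszul double complexes.  The first
-- relation follows from trace (φ (x)) = q x for a basis of q elements.  In degree 0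
-- there are no coboundaries and the morphism is the identity, whence the injectivity.
module Submission where

open import Defs
open import Algebra.Bundles using (AbelianGroup; CommutativeRing)
import Algebra.Properties.AbelianGroup
import Algebra.Properties.CommutativeMonoid.Sum
import Algebra.Properties.Semiring.Sum
open import Data.Bool.Base using (true; false)
open import Data.Fin.Base using (Fin; zero; suc)
open import Data.Fin.Subset using (∣_∣)
open import Data.List.Base using ([]; _∷_)
open import Data.Nat.Base using (ℕ; zero; suc)
open import Data.Nat.Primality using (Prime)
open import Data.Nat.Properties using (_≟_)
open import Data.Product.Base using (Σ-syntax; _×_; _,_)
open import Data.Vec.Base using (lookup)
open import Function.Base using (_∘_)
open import Function.Bundles using (Inverse)
import Relation.Binary.Reasoning.Setoid
open import Relation.Nullary using (yes; no)

-- Traces of scalars with respect to a finite basis.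

⟦⟧-fromℕ : ∀ {A B} (f : Hom A B) n → CommutativeRing._≈_ B (⟦ f ⟧ (Ops.fromℕ A n)) (Ops.fromℕ B n)
⟦⟧-fromℕ         f zero    = Hom.0#-homo f
⟦⟧-fromℕ {B = B} f (suc n) = B.trans (Hom.+-homo f _ _) (B.+-cong (Hom.1#-homo f) (⟦⟧-fromℕ f n))
  where module B = CommutativeRing B

module _ {A : CRing} where
  private
    module A where
      open CommutativeRing A public
      open Ops A public using (fromℕ)
      open Algebra.Properties.Semiring.Sum semiring public

  sum-const : ∀ n a → A.sum {n} (λ _ → a) A.≈ A.fromℕ n A.* a
  sum-const zero    a = A.sym (A.zeroˡ a)
  sum-const (suc n) a = A.sym (A.trans (A.distribʳ a A.1# (A.fromℕ n))
    (A.+-cong (A.*-identityˡ a) (A.sym (sum-const n a))))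

  -- Kronecker delta, by recursion on both indices so that `sum-δ` can follow the recursion of the
  -- finite sum.
  δ : ∀ {n} → Fin n → Fin n → A.Carrier
  δ zero    zero    = A.1#
  δ zero    (suc _) = A.0#
  δ (suc _) zero    = A.0#
  δ (suc i) (suc j) = δ i j

  δ-diag : ∀ {n} (i : Fin n) → δ i i A.≈ A.1#
  δ-diag zero    = A.refl
  δ-diag (suc i) = δ-diag i

module _ {A B : CRing} (f : Hom A B) where
  private
    module B where
      open CommutativeRing B public
      open Algebra.Properties.Semiring.Sum semiring public

  sum-δ : ∀ {n} (i : Fin n) (b : Fin n → B.Carrier) → B.sum (λ j → ⟦ f ⟧ (δ {A} i j) B.* b j) B.≈ b i
  sum-δ {suc n} zero b = B.trans
    (B.+-cong (B.trans (B.*-congʳ (Hom.1#-homo f)) (B.*-identityˡ _))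
      (B.trans (B.sum-cong-≋ {n} (λ _ → B.trans (B.*-congʳ (Hom.0#-homo f)) (B.zeroˡ _))) (B.sum-replicate-zero n)))
    (B.+-identityʳ _)
  sum-δ (suc i) b = B.trans
    (B.+-cong (B.trans (B.*-congʳ (Hom.0#-homo f)) (B.zeroˡ _)) (sum-δ i (b ∘ suc)))
    (B.+-identityˡ _)

module _ {A B : CRing} {f : Hom A B} {n : ℕ} {b : Fin n → CommutativeRing.Carrier B} (basis : IsBasis f n b) where
  open IsBasis basis
  private
    module A where
      open CommutativeRing A public
      open Ops A public using (fromℕ)
      open Algebra.Properties.Semiring.Sum semiring public
    module B = CommutativeRing B

  -- The family `δ i` expands `b i` in the basis, and coordinates are unique.
  coord-diag : ∀ i → coord (b i) i A.≈ A.1#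
  coord-diag i = A.trans (A.sym (unique (b i) (δ {A} i) (B.sym (sum-δ f i b)) i)) (δ-diag {A} i)

  -- Multiplication by a scalar has a diagonal matrix whose n diagonal entries are all `a`.
  trace-scalar : ∀ a → trace (⟦ f ⟧ a) A.≈ A.fromℕ n A.* a
  trace-scalar a = A.trans
    (A.sum-cong-≋ {n} (λ i → A.trans (coord-scale basis a (b i) i)
      (A.trans (A.*-congˡ (coord-diag i)) (A.*-identityʳ a))))
    (sum-const {A} n a)

-- The composite of ψ with φ, on `Ô` and then on M.

module _ {p : ℕ} {F : LocalField p} {LT : LubinTate F} {C : AlgebraicClosure LT}
         {X : LubinTateCharacter C} {B : BaseField X} {P : Perfection B}
         {𝕎 : WittRings P} {U : LubinTateElement 𝕎} {E : CoefficientRings U}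
         (Ψ : PsiOperator E) where
  open LocalField F
  open CoefficientRings E
  open CoefficientModule E
  open PsiOperator Ψ
  private
    module kL = CommutativeRing kL
    module OL = Ops OL
    module Ô = CommutativeRing Ô
    module Ê where
      open CommutativeRing Ê public
      open Ops Ê public using (fromℕ)

    OL→Ê : Hom OL Ê
    OL→Ê = Ô→Ê ⊚ OL→Ô

  -- By `OL`-linearity of `φ-Ô`, its value at a = a · 1 is a · φ(1) = a.
  φO-OL : ∀ a → ⟦ φO ⟧ (⟦ OL→Ô ⟧ a) Ô.≈ ⟦ OL→Ô ⟧ a
  φO-OL a = Ô.trans (Hom.⟦⟧-cong φO (Ô.sym (Ô.*-identityʳ _)))
    (Ô.trans (LinearMap.linear φ-Ô a Ô.1#) (Ô.trans (Ô.*-congˡ (Hom.1#-homo φO)) (Ô.*-identityʳ _)))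

  -- The relation π · (q/π) = q of `OL` is carried to `Ê`, where `π⁻¹` cancels π.
  π⁻¹q : π⁻¹ Ê.* Ê.fromℕ q Ê.≈ ⟦ OL→Ê ⟧ q/π
  π⁻¹q = begin
    π⁻¹ Ê.* Ê.fromℕ q                       ≈⟨ Ê.*-congˡ (⟦⟧-fromℕ OL→Ê q) ⟨
    π⁻¹ Ê.* ⟦ OL→Ê ⟧ (OL.fromℕ q)           ≈⟨ Ê.*-congˡ (Hom.⟦⟧-cong OL→Ê q/π-quotient) ⟨
    π⁻¹ Ê.* ⟦ OL→Ê ⟧ (π OL.* q/π)           ≈⟨ Ê.*-congˡ (Hom.*-homo OL→Ê π q/π) ⟩
    π⁻¹ Ê.* (⟦ OL→Ê ⟧ π Ê.* ⟦ OL→Ê ⟧ q/π)   ≈⟨ Ê.*-assoc _ _ _ ⟨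
    π⁻¹ Ê.* ⟦ OL→Ê ⟧ π Ê.* ⟦ OL→Ê ⟧ q/π     ≈⟨ Ê.*-congʳ (Ê.trans (Ê.*-comm _ _) π⁻¹-inverse) ⟩
    Ê.1# Ê.* ⟦ OL→Ê ⟧ q/π                   ≈⟨ Ê.*-identityˡ _ ⟩
    ⟦ OL→Ê ⟧ q/π                            ∎
    where open Relation.Binary.Reasoning.Setoid Ê.setoid

  -- Since `ψ` is characterised through its image under `φÊ`, both sides are compared after the
  -- injections `Ô→Ê` and `φÊ`.
  ψO-φO : ∀ x → ψO (⟦ φO ⟧ x) Ô.≈ ⟦ OL→Ô ⟧ q/π Ô.* x
  ψO-φO x = IsFractionField.injective Ê-fractions
    -- Injectivity of `φÊ` needs a basis index, hence q > 0; the zero of `kL`, a field with q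
    -- elements, supplies one.
    (basis-injective Ê-degree (Inverse.from kL-cardinality kL.0#) (begin
      ⟦ φÊ ⟧ (⟦ Ô→Ê ⟧ (ψO (⟦ φO ⟧ x)))
        ≈⟨ Hom.⟦⟧-cong φÊ (ψO-restricts _) ⟩
      ⟦ φÊ ⟧ (ψ (⟦ Ô→Ê ⟧ (⟦ φO ⟧ x)))
        ≈⟨ ψ-trace _ ⟩
      π⁻¹ Ê.* ⟦ φÊ ⟧ (trace (⟦ Ô→Ê ⟧ (⟦ φO ⟧ x)))
        -- The image of φ(x) in `Ê` is `φÊ` of `y`, a scalar for the extension given by `φÊ`, so its
        -- trace is q · y.
        ≈⟨ Ê.*-congˡ (Hom.⟦⟧-cong φÊ (Ê.trans (trace-cong Ê-degree (Ê.sym (φÊ-extends x))) (trace-scalar Ê-degree y))) ⟩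
      π⁻¹ Ê.* ⟦ φÊ ⟧ (Ê.fromℕ q Ê.* y)
        ≈⟨ Ê.*-congˡ (Ê.trans (Hom.*-homo φÊ _ _) (Ê.*-congʳ (⟦⟧-fromℕ φÊ q))) ⟩
      π⁻¹ Ê.* (Ê.fromℕ q Ê.* ⟦ φÊ ⟧ y)
        ≈⟨ Ê.*-assoc _ _ _ ⟨
      π⁻¹ Ê.* Ê.fromℕ q Ê.* ⟦ φÊ ⟧ y
        ≈⟨ Ê.*-congʳ π⁻¹q ⟩
      ⟦ OL→Ê ⟧ q/π Ê.* ⟦ φÊ ⟧ y
        -- φ fixes q/π, which can therefore be absorbed into the argument of `φÊ`.
        ≈⟨ Ê.*-congʳ (Ê.trans (φÊ-extends _) (Hom.⟦⟧-cong Ô→Ê (φO-OL q/π))) ⟨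
      ⟦ φÊ ⟧ (⟦ OL→Ê ⟧ q/π) Ê.* ⟦ φÊ ⟧ y
        ≈⟨ Hom.*-homo φÊ _ _ ⟨
      ⟦ φÊ ⟧ (⟦ OL→Ê ⟧ q/π Ê.* y)
        ≈⟨ Hom.⟦⟧-cong φÊ (Hom.*-homo Ô→Ê _ x) ⟨
      ⟦ φÊ ⟧ (⟦ Ô→Ê ⟧ (⟦ OL→Ô ⟧ q/π Ô.* x)) ∎))
    where
      open Relation.Binary.Reasoning.Setoid Ê.setoid
      open IsBasis Ê-degree using (trace)
      y : Ê.Carrier
      y = ⟦ Ô→Ê ⟧ x

  module _ {M : ΦΓModule E} {V : Representation X} (D : IsDLT M V) where
    open PsiOnModule Ψ D
    private
      module M = ΦΓModule M
      module V = Representation V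
      module D = IsDLT D
    open Tensor OL Ô-OL V.module-OL

    ψ⊗id-φ⊗id : ∀ t → ψ⊗id ((φ-Ô ⊗ idLinear OL V.module-OL) t) ~
                      (multiplication (⟦ OL→Ô ⟧ q/π) ⊗ idLinear OL V.module-OL) t
    ψ⊗id-φ⊗id []            = ~-refl
    ψ⊗id-φ⊗id ((x , y) ∷ t) = ++-cong (pair (ψO-φO x) V.≈ᴹ-refl) (ψ⊗id-φ⊗id t)

    -- `D.iso` is injective and compatible with φ and ψ, so the relation is checked on formal sums,
    -- pair by pair, where it is `ψO-φO` in the first factor.
    ψM-φ : ∀ x → ψM (M.φ x) M.≈ᴹ ⟦ OL→OE ⟧ q/π M.*ₗ x
    ψM-φ x = D.injective (~-trans (ψM-iso _)
      (~-trans (⊗-cong (ψ-Ô Ψ) (idLinear OL V.module-OL) (D.φ-homo x))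
        (~-trans (ψ⊗id-φ⊗id (D.iso x)) (~-sym (D.linear _ x)))))

-- Negated homomorphisms and functoriality of cohomology.

module _ {G H : Ab} where
  open AbelianGroup H
  open Algebra.Properties.AbelianGroup H using (⁻¹-∙-comm)

  negᴳ : GroupHom G H → GroupHom G H
  negᴳ f = groupHom (λ x → apply f x ⁻¹) (⁻¹-cong ∘ GroupHom.⟦⟧-cong f)
    (λ x y → trans (⁻¹-cong (GroupHom.homo f x y)) (sym (⁻¹-∙-comm _ _)))

-- Cohomology classes are compared through the difference of representatives, so equal cochains need
-- a primitive of zero: `ε` in positive degree. In degree 0 a coboundary is by definition zero.
≈⇒coboundary : ∀ (C : Complex) i {x y} → AbelianGroup._≈_ (Complex.X C i) x y →
               Cohomology.IsCoboundary C i (AbelianGroup._-_ (Complex.X C i) x y)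
≈⇒coboundary C zero        x≈y = trans (∙-congʳ x≈y) (inverseʳ _)
  where open AbelianGroup (Complex.X C 0)
≈⇒coboundary C (suc i) {y = y} x≈y = AbelianGroup.ε (X i) , trans (GroupHom.ε-homo (d i)) (sym (trans (∙-congʳ x≈y) (inverseʳ y)))
  where
    open Complex C
    open AbelianGroup (X (suc i))

module _ {C D : Complex} (g : ComplexHom C D) where
  private
    module C = Complex C
    module D = Complex D
    module g = ComplexHom g

  map-cocycle : ∀ i x → Cohomology.IsCocycle C i x → Cohomology.IsCocycle D i (apply (g.map i) x)
  map-cocycle i x dx≈ε = trans (g.commutes i x) (trans (GroupHom.⟦⟧-cong (g.map (suc i)) dx≈ε) (GroupHom.ε-homo (g.map (suc i))))
    where open AbelianGroup (D.X (suc i))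

  map-coboundary : ∀ i {x y} → Cohomology.IsCoboundary C i (AbelianGroup._-_ (C.X i) x y) →
                   Cohomology.IsCoboundary D i (AbelianGroup._-_ (D.X i) (apply (g.map i) x) (apply (g.map i) y))
  map-coboundary zero {x} {y} x-y≈ε = trans (sym (trans (GroupHom.homo (g.map 0) _ _) (∙-congˡ (GroupHom.⁻¹-homo (g.map 0) y))))
      (trans (GroupHom.⟦⟧-cong (g.map 0) x-y≈ε) (GroupHom.ε-homo (g.map 0)))
    where open AbelianGroup (D.X 0)
  map-coboundary (suc i) {x} {y} (w , dw≈x-y) = apply (g.map i) w ,
      trans (g.commutes i w) (trans (GroupHom.⟦⟧-cong (g.map (suc i)) dw≈x-y)
        (trans (GroupHom.homo (g.map (suc i)) _ _) (∙-congˡ (GroupHom.⁻¹-homo (g.map (suc i)) y))))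
    where open AbelianGroup (D.X (suc i))

  ℋ-map : ∀ i → GroupHom (ℋ C i) (ℋ D i)
  ℋ-map i = groupHom (λ (x , dx≈ε) → apply (g.map i) x , map-cocycle i x dx≈ε)
    (map-coboundary i)
    (λ (x , _) (y , _) → ≈⇒coboundary D i (GroupHom.homo (g.map i) x y))

  ℋ-map-induced : IsInducedOnCohomology g ℋ-map
  ℋ-map-induced i x dx≈ε = map-cocycle i x dx≈ε , ≈⇒coboundary D i (AbelianGroup.refl (D.X i))

-- Functoriality of the Koszul complex and of its total complex.

module _ {G H : Ab} (f : GroupHom G H) where
  private
    module G where
      open AbelianGroup G public
      open Algebra.Properties.CommutativeMonoid.Sum commutativeMonoid public using (sum)
      open KoszulSum G public
    module H where
      open AbelianGroup H public
      open Algebra.Properties.CommutativeMonoid.Sum commutativeMonoid public using (sum; sum-cong-≋)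
      open KoszulSum H public
      open Sign H public

  sum-map : ∀ {n} (t : Fin n → G.Carrier) → apply f (G.sum t) H.≈ H.sum (apply f ∘ t)
  sum-map {zero}  t = GroupHom.ε-homo f
  sum-map {suc n} t = H.trans (GroupHom.homo f _ _) (H.∙-congˡ (sum-map (t ∘ suc)))

  ⊖-idᴳ-map : (α : GroupHom G G) (β : GroupHom H H) → (∀ x → apply β (apply f x) H.≈ apply f (apply α x)) →
              ∀ x → apply (β ⊖ idᴳ) (apply f x) H.≈ apply f (apply (α ⊖ idᴳ) x)
  ⊖-idᴳ-map α β βf≈fα x = H.sym (H.trans (GroupHom.homo f _ _)
    (H.∙-cong (H.sym (βf≈fα x)) (GroupHom.⁻¹-homo f x)))

  -- A homomorphism preserves sums and signs, so intertwining each pair of operators suffices. The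
  -- groups may differ, as needed for maps between two complexes.
  koszul-map : ∀ {n} (α : Fin n → GroupHom G G) (β : Fin n → GroupHom H H) →
               (∀ j x → apply (β j) (apply f x) H.≈ apply f (apply (α j) x)) →
               ∀ x T → H.koszul β (apply f ∘ x) T H.≈ apply f (G.koszul α x T)
  koszul-map {n} α β βf≈fα x T =
    H.trans (H.sum-cong-≋ {n} term) (H.sym (sum-map (G.koszulTerm α x T)))
    where
      term : ∀ j → H.koszulTerm β (apply f ∘ x) T j H.≈ apply f (G.koszulTerm α x T j)
      term j with lookup T j
      ... | true  = H.trans (H.±-cong (below j T) (βf≈fα j _)) (H.sym (±-hom f (below j T) _))
      ... | false = H.sym (GroupHom.ε-homo f)

  module _ {n} (α : Fin n → GroupHom G G) (β : Fin n → GroupHom H H)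
           (βf≈fα : ∀ j x → apply (β j) (apply f x) H.≈ apply f (apply (α j) x)) where

    extend-map : ∀ r x S → extend H β r (apply f ∘ x) S H.≈ apply f (extend G α r x S)
    extend-map r x S with ∣ S ∣ ≟ r
    ... | yes _ = H.refl
    ... | no  _ = H.sym (GroupHom.ε-homo f)

    KoszulD-map : ∀ r x T → apply (KoszulD H β r) (apply f ∘ x) T H.≈ apply f (apply (KoszulD G α r) x T)
    KoszulD-map r x (T , _) = H.trans
      (H.koszul-cong (λ j → β j ⊖ idᴳ) _ (apply f ∘ extend G α r x) (extend-map r x) T)
      (koszul-map (λ j → α j ⊖ idᴳ) (λ j → β j ⊖ idᴳ) (λ j → ⊖-idᴳ-map (α j) (β j) (βf≈fα j)) (extend G α r x) T)

module _ {n : ℕ} {C D : OperatorComplex n} where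
  private
    module C = OperatorComplex C
    module D = OperatorComplex D

  module _ (f : ComplexHom C.complex D.complex) where
    private
      module f = ComplexHom f

    KoszulX-map : ∀ r s → GroupHom (KoszulX (C.X s) (λ j → C.γ j s) r) (KoszulX (D.X s) (λ j → D.γ j s) r)
    KoszulX-map r s = groupHom (λ x S → apply (f.map s) (x S))
      (λ p S → GroupHom.⟦⟧-cong (f.map s) (p S)) (λ x y S → GroupHom.homo (f.map s) (x S) (y S))

    -- Commuting with the operators gives compatibility with the horizontal Koszul differentials;
    -- being a morphism of complexes gives it for the vertical ones.
    TotKoszul-map : (∀ j s x → AbelianGroup._≈_ (D.X s) (apply (D.γ j s) (apply (f.map s) x)) (apply (f.map s) (apply (C.γ j s) x))) →
                    ComplexHom (TotKoszul C) (TotKoszul D)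
    TotKoszul-map f-γ = record { map = map ; commutes = commutes }
      where
        map : ∀ m → GroupHom (Complex.X (TotKoszul C) m) (Complex.X (TotKoszul D) m)
        map m = groupHom (λ x (r , s , e) → apply (KoszulX-map r s) (x (r , s , e)))
          (λ p (r , s , e) → GroupHom.⟦⟧-cong (KoszulX-map r s) (p (r , s , e)))
          (λ x y (r , s , e) → GroupHom.homo (KoszulX-map r s) (x (r , s , e)) (y (r , s , e)))

        commutes : ∀ m x → AbelianGroup._≈_ (Complex.X (TotKoszul D) (suc m))
          (apply (Complex.d (TotKoszul D) m) (apply (map m) x))
          (apply (map (suc m)) (apply (Complex.d (TotKoszul C) m) x))
        -- On the two edges of the double complex only one differential reaches the component; the
        -- corner (0, 0) does not occur in positive total degree.
        commutes m x (zero  , suc s , e) S = f.commutes s _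
        commutes m x (suc r , zero  , e)   = KoszulD-map (f.map 0) (λ j → C.γ j 0) (λ j → D.γ j 0) (λ j → f-γ j 0) r _
        commutes m x (suc r , suc s , e)   = trans
          (∙-cong (KoszulD-map (f.map (suc s)) (λ j → C.γ j (suc s)) (λ j → D.γ j (suc s)) (λ j → f-γ j (suc s)) r _)
            -- The sign depends only on the row index, which the map keeps, and homomorphisms
            -- preserve it.
            (trans (±-cong (suc r) (λ S → f.commutes s _)) (sym (±-hom (KoszulX-map (suc r) (suc s)) (suc r) _))))
          (sym (GroupHom.homo (KoszulX-map (suc r) (suc s)) _ _))
          where
            Y : Ab
            Y = KoszulX (D.X (suc s)) (λ j → D.γ j (suc s)) (suc r)
            open AbelianGroup Y
            open Sign Y

    TotKoszul-map-induced : ∀ f-γ → IsInducedBy {C = C} {D = D} f (TotKoszul-map f-γ)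
    TotKoszul-map-induced f-γ m x r s e S = AbelianGroup.refl (D.X s)

-- The morphism from the Φ-complex to the Ψ-complex.

module _ {p : ℕ} {F : LocalField p} {LT : LubinTate F} {C : AlgebraicClosure LT}
         {X : LubinTateCharacter C} {B : BaseField X} {P : Perfection B}
         {𝕎 : WittRings P} {U : LubinTateElement 𝕎} {E : CoefficientRings U}
         (Ψ : PsiOperator E) {M : ΦΓModule E} {V : Representation X} (D : IsDLT M V) where
  open BaseField B using (γ)
  open PsiOperator Ψ using (q/π)
  open PsiOnModule Ψ D
  open ΦΓModule M using (_≈ᴹ_; ≈ᴹ-refl; ≈ᴹ-sym; ≈ᴹ-trans; +ᴹ-cong; -ᴹ‿cong; +ᴹ-abelianGroup)
  open Algebra.Properties.AbelianGroup +ᴹ-abelianGroup using (⁻¹-anti-homo‿-)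
  private
    ψᴹ φᴹ : GroupHom (M ^Δ) (M ^Δ)
    ψᴹ = ψΔ M Ψ D
    φᴹ = φΔ M
    module Φ• = OperatorComplex (Φ• M)
    module Ψ• = OperatorComplex (Ψ• M Ψ D)

  -- Read from right to left: additivity gives -((q/π)x - ψx), and the outer sign swaps the
  -- difference.
  -ψ∘[φ-id] : ∀ x → AbelianGroup._≈_ (M ^Δ) (apply (ψᴹ ⊖ scaleΔ M q/π) x) (apply (negᴳ ψᴹ) (apply (φᴹ ⊖ idᴳ) x))
  -ψ∘[φ-id] x = ≈ᴹ-sym (≈ᴹ-trans (-ᴹ‿cong (≈ᴹ-trans (ψM-add _ _)
      (+ᴹ-cong (ψM-φ Ψ D _) (GroupHom.⁻¹-homo ψᴹ x))))
    (⁻¹-anti-homo‿- _ _))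

  -ψ-γ : ∀ j x → AbelianGroup._≈_ (M ^Δ) (apply (γΔ M j) (apply (negᴳ ψᴹ) x)) (apply (negᴳ ψᴹ) (apply (γΔ M j) x))
  -ψ-γ j x = ≈ᴹ-trans (GroupHom.⁻¹-homo (γΔ M j) (apply ψᴹ x)) (-ᴹ‿cong (ψM-act (γ j) _))

  Φ→Ψ : ComplexHom Φ•.complex Ψ•.complex
  Φ→Ψ = record { map = map ; commutes = commutes }
    where
      map : ∀ s → GroupHom (Φ•.X s) (Ψ•.X s)
      map 0             = idᴳ
      map 1             = negᴳ ψᴹ
      -- From degree 2 on both complexes consist of the same trivial group.
      map (suc (suc _)) = idᴳ

      commutes : ∀ s x → AbelianGroup._≈_ (Ψ•.X (suc s)) (apply (Ψ•.d s) (apply (map s) x)) (apply (map (suc s)) (apply (Φ•.d s) x))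
      commutes zero    = -ψ∘[φ-id]
      commutes (suc _) = _

  Φ→Ψ-γ : ∀ j s x → AbelianGroup._≈_ (Ψ•.X s) (apply (Ψ•.γ j s) (apply (ComplexHom.map Φ→Ψ s) x))
                                              (apply (ComplexHom.map Φ→Ψ s) (apply (Φ•.γ j s) x))
  Φ→Ψ-γ j 0             x = ≈ᴹ-refl
  Φ→Ψ-γ j 1             x = -ψ-γ j x
  Φ→Ψ-γ j (suc (suc _)) x = _

  ΦΓ→ΨΓ : ComplexHom (ΦΓ• M) (ΨΓ• M Ψ D)
  ΦΓ→ΨΓ = TotKoszul-map {C = Φ• M} {D = Ψ• M Ψ D} Φ→Ψ Φ→Ψ-γ

theorem5p6 :
  ∀ (p : ℕ) → Prime p →
  (F : LocalField p) (LT : LubinTate F) (C : AlgebraicClosure LT) (X : LubinTateCharacter C)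
  (B : BaseField X) (P : Perfection B) (𝕎 : WittRings P) (U : LubinTateElement 𝕎)
  (E : CoefficientRings U) (Ψ : PsiOperator E)
  (M : ΦΓModule E) → IsLimitOfTorsionÉtale E M →
  (V : Representation X) (D : IsDLT M V) →
  Σ[ f ∈ ComplexHom (OperatorComplex.complex (Φ• M)) (OperatorComplex.complex (Ψ• M Ψ D)) ]
    ((∀ x → AbelianGroup._≈_ (M ^Δ) (apply (ComplexHom.map f 0) x) x)
     × (∀ x → AbelianGroup._≈_ (M ^Δ) (apply (ComplexHom.map f 1) x)
                                      (AbelianGroup._⁻¹ (M ^Δ) (apply (ψΔ M Ψ D) x)))
     × Σ[ g ∈ ComplexHom (ΦΓ• M) (ΨΓ• M Ψ D) ]
       (IsInducedBy {C = Φ• M} {D = Ψ• M Ψ D} f g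
        × Σ[ h ∈ (∀ i → GroupHom (ℋ (ΦΓ• M) i) (ℋ (ΨΓ• M Ψ D) i)) ]
          (IsInducedOnCohomology g h
           × (∀ x y → AbelianGroup._≈_ (ℋ (ΨΓ• M Ψ D) 0) (apply (h 0) x) (apply (h 0) y) →
              AbelianGroup._≈_ (ℋ (ΦΓ• M) 0) x y))))
theorem5p6 p _ F LT C X B P 𝕎 U E Ψ M _ V D =
  Φ→Ψ Ψ D , (λ _ → ≈ᴹ-refl) , (λ _ → ≈ᴹ-refl) ,
  ΦΓ→ΨΓ Ψ D , TotKoszul-map-induced {C = Φ• M} {D = Ψ• M Ψ D} (Φ→Ψ Ψ D) (Φ→Ψ-γ Ψ D) ,
  ℋ-map (ΦΓ→ΨΓ Ψ D) , ℋ-map-induced (ΦΓ→ΨΓ Ψ D) ,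
  -- The only bidegree of total degree 0 is (0, 0), where the map is the identity on cochains;
  -- equality of classes is there the vanishing of the difference, so the hypothesis is already the
  -- conclusion.
  λ { _ _ x≈y (zero , zero , e) → x≈y (zero , zero , e) }
  where open ΦΓModule M using (≈ᴹ-refl)
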